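{- Every formula of $\mathcal{L}_\mu$ is equivalent over the class of all $\mathsf{wK4}$ models to a formula of $\mathcal{L}_\mu$ with no nested fixed points, i.e. a formula having no subformula of the form $\rho_0x.\phi$ in which some subformula $\rho_1y.\psi$ of $\phi$ (with $\rho_0,\rho_1\in\{\mu,\nu\}$) contains a free occurrence of $x$. In particular the $\mu$-calculus collapses to its alternation-free fragment over $\mathsf{wK4}$ frames.
   Context: A Kripke model is $M=\langle M,\sqsubset,\|\cdot\|\rangle$; $\mathsf{wK4}$ means: for all $a\neq c$, $a\sqsubset b\sqsubset c$ implies $a\sqsubset c$. $\mathcal{L}_\mu$ (negation normal form): $\varphi::=\top\mid x\mid p\mid\neg p\mid\varphi\wedge\varphi\mid\varphi\vee\varphi\mid\Diamond\varphi\mid\Box\varphi\mid\nu x.\varphi\mid\mu x.\varphi$ with standard Kripke semantics ($\Diamond$/$\Box$ over $\sqsubset$-successors; $\mu,\nu$ least/greatest fixed points). Two formulas are equivalent over a class of models if they have the same extension in every model of the class. -}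

module Defs where

open import Data.Bool.Base using (Bool; T; if_then_else_)
open import Data.Nat.Base using (ℕ)
open import Data.Nat.Properties using (_≟_)
open import Data.Product.Base using (Σ-syntax; ∃-syntax; _×_)
open import Data.Sum.Base using (_⊎_)
open import Data.Unit.Polymorphic.Base using (⊤)
open import Function.Bundles using (_⇔_)
open import Level using (Level; Lift; suc; _⊔_)
open import Relation.Binary.Core using (Rel)
open import Relation.Binary.PropositionalEquality using (_≢_)
open import Relation.Nullary.Decidable.Core using (does)
open import Relation.Nullary.Negation.Core using (¬_)
open import Relation.Unary using (Pred; _⊆_)

private
  variable
    ℓ c : Level

Atom Var : Set
Atom = ℕ
Var  = ℕ

data Fix : Set where
  `μ `ν : Fix

infixr 7 _`∧_
infixr 6 _`∨_

data Formula : Set where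
  `⊤        : Formula
  `var      : Var → Formula
  `atom     : Atom → Formula
  `¬atom    : Atom → Formula
  _`∧_ _`∨_ : Formula → Formula → Formula
  `◇ `□     : Formula → Formula
  `fix      : Fix → Var → Formula → Formula

infix 4 _≼_ _FreeIn_

-- φ ≼ ψ : φ is a subformula of ψ, possibly ψ itself.
data _≼_ (φ : Formula) : Formula → Set where
  here : φ ≼ φ
  ∧ˡ   : ∀ {ψ χ} → φ ≼ ψ → φ ≼ ψ `∧ χ
  ∧ʳ   : ∀ {ψ χ} → φ ≼ χ → φ ≼ ψ `∧ χ
  ∨ˡ   : ∀ {ψ χ} → φ ≼ ψ → φ ≼ ψ `∨ χ
  ∨ʳ   : ∀ {ψ χ} → φ ≼ χ → φ ≼ ψ `∨ χ
  ◇    : ∀ {ψ} → φ ≼ ψ → φ ≼ `◇ ψ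
  □    : ∀ {ψ} → φ ≼ ψ → φ ≼ `□ ψ
  fix  : ∀ {ρ x ψ} → φ ≼ ψ → φ ≼ `fix ρ x ψ

data _FreeIn_ (x : Var) : Formula → Set where
  var : x FreeIn `var x
  ∧ˡ  : ∀ {φ ψ} → x FreeIn φ → x FreeIn φ `∧ ψ
  ∧ʳ  : ∀ {φ ψ} → x FreeIn ψ → x FreeIn φ `∧ ψ
  ∨ˡ  : ∀ {φ ψ} → x FreeIn φ → x FreeIn φ `∨ ψ
  ∨ʳ  : ∀ {φ ψ} → x FreeIn ψ → x FreeIn φ `∨ ψ
  ◇   : ∀ {φ} → x FreeIn φ → x FreeIn `◇ φ
  □   : ∀ {φ} → x FreeIn φ → x FreeIn `□ φ
  fix : ∀ {ρ y φ} → x ≢ y → x FreeIn φ → x FreeIn `fix ρ y φ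

NoNestedFixedPoints : Formula → Set
NoNestedFixedPoints χ =
  ∀ {ρ₀ ρ₁ x y φ ψ} →
  `fix ρ₀ x φ ≼ χ → `fix ρ₁ y ψ ≼ φ → ¬ (x FreeIn `fix ρ₁ y ψ)

AlternationFree : Formula → Set
AlternationFree χ =
  ∀ {ρ₀ ρ₁ x y φ ψ} → ρ₀ ≢ ρ₁ →
  `fix ρ₀ x φ ≼ χ → `fix ρ₁ y ψ ≼ φ → ¬ (x FreeIn `fix ρ₁ y ψ)

-- The powerset used for valuations and fixed points consists of two-valued
-- characteristic functions: unlike W → Set ℓ it lives in Set ℓ, so one can
-- quantify over it without leaving Set ℓ.  Under ExcludedMiddle ℓ every
-- predicate W → Set ℓ is (pointwise equivalent to) such a function, so this is
-- then the full classical powerset, and μ and ν below denote genuine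
-- least and greatest fixed points.
Subset : Set ℓ → Set ℓ
Subset W = W → Bool

⟪_⟫ : {W : Set ℓ} → Subset W → Pred W ℓ
⟪_⟫ {ℓ} X w = Lift ℓ (T (X w))

record Model ℓ : Set (suc ℓ) where
  infix 4 _⊏_
  field
    World : Set ℓ
    _⊏_   : Rel World ℓ
    ‖_‖   : Atom → Subset World

WK4 : Model ℓ → Set ℓ
WK4 M = ∀ {a b c} → a ≢ c → a ⊏ b → b ⊏ c → a ⊏ c
  where open Model M

module Semantics (M : Model ℓ) where
  open Model M

  Assignment : Set ℓ
  Assignment = Var → Subset World

  _[_↦_] : Assignment → Var → Subset World → Assignment
  (V [ x ↦ X ]) y = if does (x ≟ y) then X else V y

  -- ⟦ μx.φ ⟧ is the intersection of all X with ⟦ φ ⟧(X) ⊆ X, and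
  -- ⟦ νx.φ ⟧ the union of all X with X ⊆ ⟦ φ ⟧(X).
  ⟦_⟧ : Formula → Assignment → Pred World ℓ
  ⟦ `⊤ ⟧         V w = ⊤
  ⟦ `var x ⟧     V w = ⟪ V x ⟫ w
  ⟦ `atom p ⟧    V w = ⟪ ‖ p ‖ ⟫ w
  ⟦ `¬atom p ⟧   V w = ¬ ⟪ ‖ p ‖ ⟫ w
  ⟦ φ `∧ ψ ⟧     V w = ⟦ φ ⟧ V w × ⟦ ψ ⟧ V w
  ⟦ φ `∨ ψ ⟧     V w = ⟦ φ ⟧ V w ⊎ ⟦ ψ ⟧ V w
  ⟦ `◇ φ ⟧       V w = ∃[ v ] w ⊏ v × ⟦ φ ⟧ V v
  ⟦ `□ φ ⟧       V w = ∀ v → w ⊏ v → ⟦ φ ⟧ V v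
  ⟦ `fix `μ x φ ⟧ V w =
    (X : Subset World) → ⟦ φ ⟧ (V [ x ↦ X ]) ⊆ ⟪ X ⟫ → ⟪ X ⟫ w
  ⟦ `fix `ν x φ ⟧ V w =
    Σ[ X ∈ Subset World ] ⟪ X ⟫ ⊆ ⟦ φ ⟧ (V [ x ↦ X ]) × ⟪ X ⟫ w

-- Formulas may contain free variables; these are interpreted by an arbitrary
-- assignment.
EquivalentOver : Pred (Model ℓ) c → Formula → Formula → Set (suc ℓ ⊔ c)
EquivalentOver {ℓ} C φ ψ =
  (M : Model ℓ) → C M → let open Model M; open Semantics M in
  (V : Assignment) (w : World) → ⟦ φ ⟧ V w ⇔ ⟦ ψ ⟧ V w

{-# OPTIONS --safe #-}
module Submission where

open import Defs
open import Axiom.ExcludedMiddle using (ExcludedMiddle)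
open import Data.Bool.Base using (Bool; true; false; if_then_else_)
open import Data.Empty using (⊥-elim)
import Data.Empty.Polymorphic as ⊥ᵖ
open import Data.List.Base using (List; []; _∷_; _++_; length; cartesianProductWith)
open import Data.List.Membership.Propositional using (_∈_)
open import Data.List.Membership.Propositional.Properties
  using (∈-cartesianProductWith⁺; ∈-cartesianProductWith⁻)
open import Data.List.Relation.Unary.All as All using (All; []; _∷_)
open import Data.List.Relation.Unary.All.Properties using (++⁺; ++⁻)
open import Data.List.Relation.Unary.Any using (here; there)
open import Data.Maybe.Base using (Maybe; just; nothing)
open import Data.Nat.Base using (ℕ; zero; suc; _+_; _*_; _≤_; _<_; _⊔_; z≤n; s≤s)
open import Data.Nat.Properties
open import Data.Product.Base using (∃-syntax; Σ-syntax; _×_; _,_; proj₁; proj₂)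
open import Data.Sum.Base using (_⊎_; inj₁; inj₂; [_,_]′)
open import Data.Unit.Polymorphic.Base using (⊤; tt)
open import Function.Base using (id; _∘_; case_of_)
open import Function.Bundles using (mk⇔)
open import Level using (Level; Lift; lift; lower) renaming (suc to lsuc)
open import Relation.Binary.PropositionalEquality
  using (_≡_; refl; sym; cong₂; subst)
open import Relation.Nullary.Decidable using (yes; no; does; dec-true; dec-false)
open import Relation.Nullary.Negation.Core using (¬_; contradiction)
open import Relation.Unary using (Pred; _⊆_)

-- By duality it suffices to eliminate νx.φ(x) with φ without nested fixed
-- points; write X for its value, and let β range over the bodies of the modal
-- subformulas ◇β, □β on which φ depends after one unfolding.  Say that β is seen
-- at w if it holds at w or at a successor.  By weak transitivity the set of
-- β with ◇β in φ that are seen under x := X shrinks along ⊏, so one may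
-- describe X by recursion on this set D, knowing a formula lo for X on the
-- points where fewer β are seen.  Two observations make a stage non-nested.
--
-- (1) That all β in D stay seen is a single greatest fixed point νz.δ(z).
-- Above every point there is one around which the finitely many relevant modal
-- formulas have stabilized: they are constant except at isolated witnesses,
-- which exist only if the remaining region is one cluster.  There every inner
-- fixed point, and X itself, is reached by boundedly many iterations,
-- so that δ can be taken without fixed points.
--
-- (2) Within νz.δ(z) the diamonds are under control, and the boxes seen to hold
-- only increase along ⊏; hence boundedly many iterations of φ starting from
-- the region reach X, now with the true inner fixed points.

private
  variable
    ℓ : Level
    r : Bool
    A L B : Set

-- Flat formulas, skeletons and substitution.

data Lit : Set where
  ⊤ˡ ⊥ˡ      : Lit
  var        : Var → Lit
  atom ¬atom : Atom → Lit

data Mode : Set where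
  poss nec : Mode

infixr 7 _∧_
infixr 6 _∨_

-- Flat false consists of the formulas without nested fixed points, Flat true
-- of the bodies of their fixed points: rec is the bound variable, and a fixed
-- point inside a body can only occur under con, hence without rec.
data Flat : Bool → Set where
  lit     : Lit → Flat r
  _∧_ _∨_ : Flat r → Flat r → Flat r
  mod     : Mode → Flat r → Flat r
  rec     : Flat true
  con     : Flat false → Flat true
  fix     : Fix → Flat true → Flat false

-- Only the Boolean structure above the outermost modalities is exposed. At a point, the value of
-- such a tree depends on its leaves and on finitely many modal facts, which is what the counting
-- arguments need.
data Skeleton (L B : Set) : Set where
  leaf    : L → Skeleton L B
  _∧_ _∨_ : Skeleton L B → Skeleton L B → Skeleton L B
  mod     : Mode → B → Skeleton L B

modals : Skeleton L B → List (Mode × B)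
modals (leaf _)  = []
modals (s ∧ t)   = modals s ++ modals t
modals (s ∨ t)   = modals s ++ modals t
modals (mod k b) = (k , b) ∷ []

-- `nothing` stands for `rec`. A `con` is an opaque leaf: it stays constant while `rec` is iterated,
-- so the modalities inside it need not stabilize.
bodySkeleton : Flat true → Skeleton (Maybe (Flat false)) (Flat true)
bodySkeleton (lit l)   = leaf (just (lit l))
bodySkeleton (b ∧ c)   = bodySkeleton b ∧ bodySkeleton c
bodySkeleton (b ∨ c)   = bodySkeleton b ∨ bodySkeleton c
bodySkeleton (mod k b) = mod k b
bodySkeleton rec       = leaf nothing
bodySkeleton (con A)   = leaf (just A)

flatten : Skeleton Lit (Flat false) → Flat false
flatten (leaf l)  = lit l
flatten (s ∧ t)   = flatten s ∧ flatten t
flatten (s ∨ t)   = flatten s ∨ flatten t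
flatten (mod k A) = mod k A

embed : Flat false → Flat r
embed {false} A = A
embed {true}  A = con A

litSub : Var → Flat r → Lit → Flat r
litSub x A (var y) = if does (x ≟ y) then A else lit (var y)
litSub x A l       = lit l

sub : Var → Flat false → Flat r → Flat r
sub x C (lit l)   = litSub x (embed C) l
sub x C (A ∧ B)   = sub x C A ∧ sub x C B
sub x C (A ∨ B)   = sub x C A ∨ sub x C B
sub x C (mod k A) = mod k (sub x C A)
sub x C rec       = rec
sub x C (con A)   = con (sub x C A)
sub x C (fix ρ b) = fix ρ (sub x C b)

plug : Flat false → Flat r → Flat false
plug F (lit l)   = lit l
plug F (A ∧ B)   = plug F A ∧ plug F B
plug F (A ∨ B)   = plug F A ∨ plug F B
plug F (mod k A) = mod k (plug F A)
plug F rec       = F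
plug F (con A)   = A
plug F (fix ρ b) = fix ρ b

fixLit : Fix → Lit
fixLit `μ = ⊥ˡ
fixLit `ν = ⊤ˡ

-- Unguarded occurrences of the variable of a fixed point contribute only the
-- literal l, guarded ones are unfolded to F.
skeleton : Lit → Flat false → Flat r → Skeleton Lit (Flat false)
skeleton l F (lit l′)  = leaf l′
skeleton l F (A ∧ B)   = skeleton l F A ∧ skeleton l F B
skeleton l F (A ∨ B)   = skeleton l F A ∨ skeleton l F B
skeleton l F (mod k A) = mod k (plug F A)
skeleton l F rec       = leaf l
skeleton l F (con A)   = skeleton l F A
skeleton l F (fix ρ b) = skeleton (fixLit ρ) (fix ρ b) b

-- Among this many consecutive indices there is one at which two monotone flags
-- per list element do not change.
steps : List A → ℕ
steps []       = 1
steps (_ ∷ as) = (steps as + steps as) + (steps as + steps as)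

-- rec stands for the region, outside of which a fixed point is given by base.
chain : Fix → Flat true → (Flat true → Flat true) → ℕ → Flat true
chain `μ base f zero    = base
chain `ν base f zero    = base ∨ rec
chain `μ base f (suc k) = chain `μ base f k ∨ (rec ∧ f (chain `μ base f k))
chain `ν base f (suc k) = base ∨ (rec ∧ (chain `ν base f k ∧ f (chain `ν base f k)))

-- A fixpoint-free approximation, correct at points of the region rec around
-- which enough modal information has stabilized: e replaces x, Y replaces the
-- old rec, and fixed points are replaced by finite chains.
hat : Var → Flat false → Flat true → Flat r → Flat true → Flat true
hat x lo e (lit l)   Y = litSub x e l
hat x lo e (A ∧ B)   Y = hat x lo e A Y ∧ hat x lo e B Y
hat x lo e (A ∨ B)   Y = hat x lo e A Y ∨ hat x lo e B Y
hat x lo e (mod k A) Y = mod k (hat x lo e A Y)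
hat x lo e rec       Y = Y
hat x lo e (con A)   Y = hat x lo e A Y
hat x lo e (fix ρ b) Y =
  chain ρ (con (sub x lo (fix ρ b))) (hat x lo e b) (steps (modals (bodySkeleton b)))

near : Flat r → Flat r
near A = A ∨ mod poss A

-- A free variable has no dual literal; it is dualized by complementing the
-- assignment.
dualLit : Lit → Lit
dualLit ⊤ˡ        = ⊥ˡ
dualLit ⊥ˡ        = ⊤ˡ
dualLit (var x)   = var x
dualLit (atom p)  = ¬atom p
dualLit (¬atom p) = atom p

dualMode : Mode → Mode
dualMode poss = nec
dualMode nec  = poss

dualFix : Fix → Fix
dualFix `μ = `ν
dualFix `ν = `μ

dual : Flat r → Flat r
dual (lit l)   = lit (dualLit l)
dual (A ∧ B)   = dual A ∨ dual B
dual (A ∨ B)   = dual A ∧ dual B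
dual (mod k A) = mod (dualMode k) (dual A)
dual rec       = rec
dual (con A)   = con (dual A)
dual (fix ρ b) = fix (dualFix ρ) (dual b)

-- The formula that replaces a greatest fixed point.

module Elimination (x : Var) (s : Skeleton Lit (Flat false)) where

  -- Descending approximants of the fixed point inside a region named `rec`. Fixed points survive
  -- only under `con`, so these may occur in the body of another fixed point.
  inner : Flat false → Skeleton Lit (Flat false) → ℕ → Flat true
  inner lo t = chain `ν (con lo) (λ e → hat x lo e (flatten t) rec)

  -- Boxes impose nothing, since their visible counterexamples only multiply as the approximants
  -- shrink. `near` replaces the diamond because under weak transitivity only its reflexive version
  -- is inherited downwards.
  persist : (Flat false → Flat true) → List (Mode × Flat false) → Flat true
  persist h []                = lit ⊤ˡ
  persist h ((poss , A) ∷ as) = near (h A) ∧ persist h as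
  persist h ((nec  , A) ∷ as) = persist h as

  persistence : Flat false → Skeleton Lit (Flat false) → Flat true
  persistence lo t = persist (λ A → hat x lo (inner lo t (steps (modals t))) A rec) (modals t)

  -- The outer `near` is there because the greatest fixed point is only guaranteed at some settled
  -- point further up.
  region : Flat false → Skeleton Lit (Flat false) → Flat false
  region lo t = near (fix `ν (persistence lo t))

  -- In contrast to `inner`, the approximant is substituted into `flatten t` itself, so inner fixed
  -- points keep their true meaning. The result stays flat because inside bodies `sub` inserts it
  -- under `con`.
  outer : Flat false → Skeleton Lit (Flat false) → ℕ → Flat false
  outer lo t zero    = lo ∨ region lo t
  outer lo t (suc k) =
    lo ∨ (region lo t ∧ (outer lo t k ∧ sub x (outer lo t k) (flatten t)))

  -- One block of `steps` iterations for each possible number of seen modalities, from none to all.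
  rounds : Skeleton Lit (Flat false) → ℕ
  rounds t = suc (length (modals t)) * steps (modals t)

  stage : Flat false → Skeleton Lit (Flat false) → Flat false
  stage lo t = outer lo t (rounds t)

  stages : Flat false → List (Skeleton Lit (Flat false)) → Flat false
  stages lo []       = lo
  stages lo (t ∷ ts) = stage lo t ∨ stages lo ts

  -- One candidate for every set of diamonds that might be seen at a point; a diamond whose body is
  -- not seen is false and may be replaced by falsum.
  kills : Skeleton Lit (Flat false) → List (Skeleton Lit (Flat false))
  kills (leaf l)     = leaf l ∷ []
  kills (t ∧ u)      = cartesianProductWith _∧_ (kills t) (kills u)
  kills (t ∨ u)      = cartesianProductWith _∨_ (kills t) (kills u)
  kills (mod poss A) = leaf ⊥ˡ ∷ mod poss A ∷ []
  kills (mod nec A)  = mod nec A ∷ []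

  diamonds : Skeleton Lit (Flat false) → ℕ
  diamonds (leaf l)     = 0
  diamonds (t ∧ u)      = diamonds t + diamonds u
  diamonds (t ∨ u)      = diamonds t + diamonds u
  diamonds (mod poss A) = 1
  diamonds (mod nec A)  = 0

  -- Sound everywhere, complete where fewer than c bodies of diamonds are seen.
  low : ℕ → Flat false
  low zero    = lit ⊥ˡ
  low (suc c) = stages (low c) (kills s)

  solution : Flat false
  solution = low (suc (diamonds s))

eliminate-ν : Var → Flat false → Flat false
-- The outermost fixed points of `A` are unfolded, so that the remaining ones lie below modalities.
-- `⊤ˡ` and `A` are mere fillers at the top, where no `rec` is free.
eliminate-ν x A = Elimination.solution x (skeleton ⊤ˡ A A)

infix 4 _⇔₁_
infix 2 _⇆_
record _⇔₁_ {W : Set ℓ} (P Q : Pred W ℓ) : Set ℓ where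
  constructor _⇆_
  field
    to   : P ⊆ Q
    from : Q ⊆ P
open _⇔₁_ public

-- Classical pigeonhole and counting arguments.

module Classical {ℓ} (em : ExcludedMiddle ℓ) where

  stable : {P : Set ℓ} → ¬ ¬ P → P
  stable {P} ¬¬p with em {P}
  ... | yes p = p
  ... | no ¬p = contradiction ¬p ¬¬p

  Antitone : (ℕ → Set ℓ) → Set ℓ
  Antitone P = ∀ k → P (suc k) → P k

  antitone-≤ : ∀ {P} → Antitone P → ∀ {k l} → k ≤ l → P l → P k
  antitone-≤ anti {k} {zero}  z≤n p = p
  antitone-≤ {P} anti {k} {suc l} k≤l p with m≤n⇒m<n∨m≡n k≤l
  ... | inj₁ (s≤s k≤l′) = antitone-≤ {P} anti k≤l′ (anti l p)
  ... | inj₂ refl       = p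

  Within : ℕ → (ℕ → Set ℓ) → Set ℓ
  Within n R = ∀ a → ∃[ k ] a ≤ k × k < a + n × R k

  -- Decide `P` at the midpoint `a + n`. If it holds there, it holds throughout the first half; if
  -- it fails, it fails throughout the second half.
  halve : ∀ {n P R} → Antitone P → Within n R →
          Within (n + n) (λ k → R k × (P k → P (suc k)))
  halve {n} {P} anti find a with em {P (a + n)}
  ... | yes p = let k , a≤k , k<a+n , Rk = find a in
    k , a≤k , <-≤-trans k<a+n (+-monoʳ-≤ a (m≤m+n n n)) ,
    Rk , λ _ → antitone-≤ {P} anti k<a+n p
  ... | no ¬p = let k , a+n≤k , k<a+n+n , Rk = find (a + n) in
    k , ≤-trans (m≤m+n a n) a+n≤k , subst (k <_) (+-assoc a n n) k<a+n+n ,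
    Rk , λ Pk → contradiction (antitone-≤ {P} anti a+n≤k Pk) ¬p

  -- Two uses of `halve` per element, one for each flag; hence `steps` quadruples with each element.
  unchanging : (as : List A) (P Q : A → ℕ → Set ℓ) →
               (∀ a → Antitone (P a)) → (∀ a → Antitone (Q a)) →
               Within (steps as) (λ k → All (λ a →
                 (P a k → P a (suc k)) × (Q a k → Q a (suc k))) as)
  unchanging []       P Q antiP antiQ a = a , ≤-refl , m<m+n a (s≤s z≤n) , []
  unchanging (b ∷ bs) P Q antiP antiQ a =
    let k , a≤k , k< , (h , p) , q =
          halve {R = λ k → _ × (P b k → P b (suc k))} (antiQ b)
                (halve (antiP b) (unchanging bs P Q antiP antiQ)) a
    in k , a≤k , k< , (p , q) ∷ h

  count : (A → Set ℓ) → List A → ℕ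
  count P []       = 0
  count P (a ∷ as) with em {P a}
  ... | yes _ = suc (count P as)
  ... | no  _ = count P as

  count-≤-length : (P : A → Set ℓ) (as : List A) → count P as ≤ length as
  count-≤-length P []       = z≤n
  count-≤-length P (a ∷ as) with em {P a}
  ... | yes _ = s≤s (count-≤-length P as)
  ... | no  _ = m≤n⇒m≤1+n (count-≤-length P as)

  count-mono : {P Q : A → Set ℓ} {as : List A} →
               All (λ a → P a → Q a) as → count P as ≤ count Q as
  count-mono [] = z≤n
  count-mono {P = P} {Q} {a ∷ as} (f ∷ fs) with em {P a} | em {Q a}
  ... | yes p | yes q = s≤s (count-mono fs)
  ... | yes p | no ¬q = contradiction (f p) ¬q
  ... | no ¬p | yes q = m≤n⇒m≤1+n (count-mono fs)
  ... | no ¬p | no ¬q = count-mono fs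

  -- An inclusion of finite sets that does not increase the cardinality is an equality.
  count-≥⇒reverse : {P Q : A → Set ℓ} {as : List A} → All (λ a → P a → Q a) as →
                    count Q as ≤ count P as → All (λ a → Q a → P a) as
  count-≥⇒reverse [] _ = []
  count-≥⇒reverse {P = P} {Q} {a ∷ as} (f ∷ fs) Q≤P with em {P a} | em {Q a}
  ... | yes p | yes q = (λ _ → p) ∷ count-≥⇒reverse fs (≤-pred Q≤P)
  ... | yes p | no ¬q = contradiction (f p) ¬q
  ... | no ¬p | yes q = contradiction (≤-trans Q≤P (count-mono fs)) 1+n≰n
  ... | no ¬p | no ¬q = (λ q → contradiction q ¬q) ∷ count-≥⇒reverse fs Q≤P

-- Semantics of flat formulas: locality, fixed points and substitution.

module FlatSemantics {ℓ} (em : ExcludedMiddle ℓ) (M : Model ℓ) where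
  open Model M renaming (World to W)
  open Semantics M using (_[_↦_])
  open Classical em public

  abstract
    -- The bridge from predicates to the two-valued subsets over which fixed points quantify; it
    -- turns any predicate into an admissible invariant.
    characteristic : Pred W ℓ → Subset W
    characteristic P w = does (em {P w})

    char⁺ : ∀ {P} → P ⊆ ⟪ characteristic P ⟫
    char⁺ {P} {w} p with em {P w}
    ... | yes _ = lift _
    ... | no ¬p = contradiction p ¬p

    char⁻ : ∀ {P} → ⟪ characteristic P ⟫ ⊆ P
    char⁻ {P} {w} p with em {P w}
    ... | yes p′ = p′
    ... | no _   = ⊥-elim (lower p)

  Empty : Pred W ℓ
  Empty _ = ⊥ᵖ.⊥

  Poss Nec Near : Pred W ℓ → Pred W ℓ
  Poss P w = ∃[ v ] w ⊏ v × P v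
  Nec  P w = ∀ v → w ⊏ v → P v
  Near P w = P w ⊎ Poss P w

  Modal : Mode → Pred W ℓ → Pred W ℓ
  Modal poss = Poss
  Modal nec  = Nec

  FixedPoint : Fix → (Pred W ℓ → Pred W ℓ) → Pred W ℓ
  FixedPoint `μ F w = (X : Subset W) → F ⟪ X ⟫ ⊆ ⟪ X ⟫ → ⟪ X ⟫ w
  FixedPoint `ν F w = Σ[ X ∈ Subset W ] ⟪ X ⟫ ⊆ F ⟪ X ⟫ × ⟪ X ⟫ w

  Env : Set (lsuc ℓ)
  Env = Var → Pred W ℓ

  litSem : Lit → Env → Pred W ℓ
  litSem ⊤ˡ        V w = ⊤
  litSem ⊥ˡ        V w = ⊥ᵖ.⊥
  litSem (var y)   V w = V y w
  litSem (atom p)  V w = ⟪ ‖ p ‖ ⟫ w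
  litSem (¬atom p) V w = ¬ ⟪ ‖ p ‖ ⟫ w

  sem : Flat r → Env → Pred W ℓ → Pred W ℓ
  sem (lit l)   V Y   = litSem l V
  sem (A ∧ B)   V Y w = sem A V Y w × sem B V Y w
  sem (A ∨ B)   V Y w = sem A V Y w ⊎ sem B V Y w
  sem (mod k A) V Y   = Modal k (sem A V Y)
  sem rec       V Y   = Y
  -- `Empty` is a default value: by `sem-closed` every other choice gives the same extension.
  sem (con A)   V Y   = sem A V Empty
  sem (fix ρ b) V Y   = FixedPoint ρ (sem b V)

  ⟦_⟧ᶠ : Flat false → Env → Pred W ℓ
  ⟦ A ⟧ᶠ V = sem A V Empty

  sem-closed : (A : Flat false) → ∀ {V Y Y′} → sem A V Y ⊆ sem A V Y′
  sem-closed (lit l)        p         = p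
  sem-closed (A ∧ B)        (p , q)   = sem-closed A p , sem-closed B q
  sem-closed (A ∨ B)        (inj₁ p)  = inj₁ (sem-closed A p)
  sem-closed (A ∨ B)        (inj₂ q)  = inj₂ (sem-closed B q)
  sem-closed (mod poss A)   (v , R , p) = v , R , sem-closed A p
  sem-closed (mod nec A)    p v R     = sem-closed A (p v R)
  sem-closed (fix ρ b)      p         = p

  infix 4 _⊆[_]_
  _⊆[_]_ : Pred W ℓ → Pred W ℓ → Pred W ℓ → Set ℓ
  P ⊆[ D ] Q = ∀ {u} → D u → P u → Q u

  UpClosed : Pred W ℓ → Set ℓ
  UpClosed D = ∀ {u v} → D u → u ⊏ v → D v

  All-worlds : Pred W ℓ
  All-worlds _ = ⊤

  Modal-local : ∀ {D P Q} k → UpClosed D → P ⊆[ D ] Q → Modal k P ⊆[ D ] Modal k Q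
  Modal-local poss up P⊆Q d (v , R , p) = v , R , P⊆Q (up d R) p
  Modal-local nec  up P⊆Q d p v R       = P⊆Q (up d R) (p v R)

  Modal-mono : ∀ {P Q} k → P ⊆ Q → Modal k P ⊆ Modal k Q
  Modal-mono k P⊆Q = Modal-local {All-worlds} k (λ _ _ → tt) (λ _ → P⊆Q) tt

  -- Relativize the test set: a prefixed point `X` of `G` yields the prefixed point `D` implies `X`
  -- of `F`, and a postfixed point `X` of `F` yields the postfixed point `D` and `X` of `G`.
  FixedPoint-local : ∀ {D F G} ρ →
    (∀ {P Q} → P ⊆[ D ] Q → F P ⊆[ D ] G Q) → FixedPoint ρ F ⊆[ D ] FixedPoint ρ G
  FixedPoint-local {D} {F} `μ F⊆G d p X GX⊆X =
    char⁻ (p (characteristic (λ u → D u → ⟪ X ⟫ u))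
             (λ q → char⁺ (λ d′ → GX⊆X (F⊆G (λ d″ x → char⁻ x d″) d′ q)))) d
  FixedPoint-local {D} `ν F⊆G d (X , X⊆FX , x) =
    characteristic (λ u → D u × ⟪ X ⟫ u) ,
    (λ y → let d′ , x′ = char⁻ y in F⊆G (λ d″ x″ → char⁺ (d″ , x″)) d′ (X⊆FX x′)) ,
    char⁺ (d , x)

  FixedPoint-mono : ∀ {F G} ρ →
    (∀ {P Q} → P ⊆ Q → F P ⊆ G Q) → FixedPoint ρ F ⊆ FixedPoint ρ G
  FixedPoint-mono ρ F⊆G = FixedPoint-local {All-worlds} ρ (λ P⊆Q _ → F⊆G (P⊆Q tt)) tt

  -- Formulas look only along the accessibility relation. This is what allows every later argument
  -- to be confined to a cone.
  sem-local : ∀ {D V V′} → UpClosed D → (∀ y → V y ⊆[ D ] V′ y) →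
              (A : Flat r) → ∀ {Y Y′} → Y ⊆[ D ] Y′ → sem A V Y ⊆[ D ] sem A V′ Y′
  sem-local up V⊆ (lit (var y))   Y⊆ d p        = V⊆ y d p
  sem-local up V⊆ (lit ⊤ˡ)        Y⊆ d p        = p
  sem-local up V⊆ (lit (atom _))  Y⊆ d p        = p
  sem-local up V⊆ (lit (¬atom _)) Y⊆ d p        = p
  sem-local up V⊆ (A ∧ B)         Y⊆ d (p , q)  =
    sem-local up V⊆ A Y⊆ d p , sem-local up V⊆ B Y⊆ d q
  sem-local up V⊆ (A ∨ B)         Y⊆ d (inj₁ p) = inj₁ (sem-local up V⊆ A Y⊆ d p)
  sem-local up V⊆ (A ∨ B)         Y⊆ d (inj₂ q) = inj₂ (sem-local up V⊆ B Y⊆ d q)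
  sem-local {D = D} up V⊆ (mod k A)       Y⊆ d p        =
    Modal-local {D} k up (sem-local up V⊆ A Y⊆) d p
  sem-local up V⊆ rec             Y⊆ d p        = Y⊆ d p
  sem-local up V⊆ (con A)         Y⊆ d p        = sem-local up V⊆ A (λ _ ()) d p
  sem-local {D = D} up V⊆ (fix ρ b)       Y⊆ d p        =
    FixedPoint-local {D} ρ (sem-local up V⊆ b) d p

  sem-mono : (A : Flat r) → ∀ {V Y Y′} → Y ⊆ Y′ → sem A V Y ⊆ sem A V Y′
  sem-mono A Y⊆Y′ = sem-local {D = All-worlds} (λ _ _ → tt) (λ _ _ p → p) A (λ _ → Y⊆Y′) tt

  infixl 8 _[_≔_]
  abstract
    _[_≔_] : Env → Var → Pred W ℓ → Env
    (V [ x ≔ P ]) y = if does (x ≟ y) then P else V y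

    env-local : ∀ {D V} x {P Q} → P ⊆[ D ] Q → ∀ y → (V [ x ≔ P ]) y ⊆[ D ] (V [ x ≔ Q ]) y
    env-local x P⊆Q y with does (x ≟ y)
    ... | true  = P⊆Q
    ... | false = λ _ p → p

    env-pointwise : ∀ {V} x {P Q u} → (P u → Q u) → ∀ y → (V [ x ≔ P ]) y u → (V [ x ≔ Q ]) y u
    env-pointwise x P⇒Q y with does (x ≟ y)
    ... | true  = P⇒Q
    ... | false = id

    env-∁ : ∀ {V V′} x {P} → (∀ y → V′ y ⇔₁ (λ w → ¬ V y w)) →
            ∀ y → (V′ [ x ≔ (λ w → ¬ P w) ]) y ⇔₁ (λ w → ¬ (V [ x ≔ P ]) y w)
    env-∁ x V′≡∁V y with does (x ≟ y)
    ... | true  = id ⇆ id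
    ... | false = V′≡∁V y

    update-sem : ∀ (V : Var → Subset W) x X y →
                 ⟪ (V [ x ↦ X ]) y ⟫ ⇔₁ ((λ z → ⟪ V z ⟫) [ x ≔ ⟪ X ⟫ ]) y
    update-sem V x X y with does (x ≟ y)
    ... | true  = id ⇆ id
    ... | false = id ⇆ id

    litSub-sem : ∀ {V} x (A : Flat r) l {Y Y′} →
      sem (litSub x A l) V Y ⇔₁ sem {r} (lit l) (V [ x ≔ sem A V Y ]) Y′
    litSub-sem x A (var y) with does (x ≟ y)
    ... | true  = id ⇆ id
    ... | false = id ⇆ id
    litSub-sem x A ⊤ˡ        = id ⇆ id
    litSub-sem x A ⊥ˡ        = id ⇆ id
    litSub-sem x A (atom p)  = id ⇆ id
    litSub-sem x A (¬atom p) = id ⇆ id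

  lit-pointwise : ∀ {V x P Q u} l → (P u → Q u) → litSem l (V [ x ≔ P ]) u → litSem l (V [ x ≔ Q ]) u
  lit-pointwise {x = x} (var y) P⇒Q p = env-pointwise x P⇒Q y p
  lit-pointwise ⊤ˡ        P⇒Q p = p
  lit-pointwise (atom _)  P⇒Q p = p
  lit-pointwise (¬atom _) P⇒Q p = p

  subst-local : ∀ {D V x P Q} → UpClosed D → P ⊆[ D ] Q →
                (A : Flat r) → ∀ {Y Y′} → Y ⊆[ D ] Y′ →
                sem A (V [ x ≔ P ]) Y ⊆[ D ] sem A (V [ x ≔ Q ]) Y′
  subst-local {D = D} {x = x} up P⊆Q = sem-local up (env-local {D} x P⊆Q)

  subst-mono : ∀ {V x P Q} → P ⊆ Q → (A : Flat r) → ∀ {Y} →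
               sem A (V [ x ≔ P ]) Y ⊆ sem A (V [ x ≔ Q ]) Y
  subst-mono P⊆Q A = subst-local {D = All-worlds} (λ _ _ → tt) (λ _ → P⊆Q) A (λ _ p → p) tt

  Monotone : (Pred W ℓ → Pred W ℓ) → Set (lsuc ℓ)
  Monotone F = ∀ {P Q} → P ⊆ Q → F P ⊆ F Q

  ν-unfold : ∀ {F} → Monotone F → FixedPoint `ν F ⊆ F (FixedPoint `ν F)
  ν-unfold {F} mono (X , X⊆FX , x) =
    mono {Q = FixedPoint `ν F} (λ x′ → X , X⊆FX , x′) (X⊆FX x)

  ν-coinduction : ∀ {F P} → Monotone F → P ⊆ F P → P ⊆ FixedPoint `ν F
  ν-coinduction {P = P} mono P⊆FP p =
    characteristic P , (λ c → mono char⁺ (P⊆FP (char⁻ c))) , char⁺ p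

  -- Coinduction up to the fixed point: the union of `P` with the greatest fixed point is itself
  -- postfixed.
  ν-coinduction-∪ : ∀ {F} {P : Pred W ℓ} → Monotone F →
    (∀ {w} → P w → FixedPoint `ν F w ⊎ F (λ u → P u ⊎ FixedPoint `ν F u) w) →
    P ⊆ FixedPoint `ν F
  ν-coinduction-∪ {F} {P} mono step p = ν-coinduction mono
    [ [ mono inj₂ ∘ ν-unfold mono , id ]′ ∘ step , mono inj₂ ∘ ν-unfold mono ]′
    (inj₁ p)

  μ-induction : ∀ {F P} → Monotone F → F P ⊆ P → FixedPoint `μ F ⊆ P
  μ-induction {P = P} mono FP⊆P p =
    char⁻ (p (characteristic P) (λ c → char⁺ (FP⊆P (mono char⁻ c))))

  μ-fold : ∀ {F} → Monotone F → F (FixedPoint `μ F) ⊆ FixedPoint `μ F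
  μ-fold mono p X FX⊆X = FX⊆X (mono (λ q → q X FX⊆X) p)

  embed-sem : ∀ {V Y} r C → sem (embed {r} C) V Y ⇔₁ ⟦ C ⟧ᶠ V
  embed-sem false C = sem-closed C ⇆ sem-closed C
  embed-sem true  C = id ⇆ id

  sub-sem : ∀ {V} x C (A : Flat r) {Y} →
            sem (sub x C A) V Y ⇔₁ sem A (V [ x ≔ ⟦ C ⟧ᶠ V ]) Y
  sub-sem {r} x C (lit l) {Y} =
    subst-mono (to (embed-sem r C)) (lit {r} l) {Y} ∘ to (litSub-sem x (embed C) l {Y} {Y}) ⇆
    from (litSub-sem x (embed C) l {Y} {Y}) ∘ subst-mono (from (embed-sem r C)) (lit {r} l) {Y}
  sub-sem x C (A ∧ B) =
    (λ (p , q) → to (sub-sem x C A) p , to (sub-sem x C B) q) ⇆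
    (λ (p , q) → from (sub-sem x C A) p , from (sub-sem x C B) q)
  sub-sem x C (A ∨ B) =
    [ inj₁ ∘ to (sub-sem x C A) , inj₂ ∘ to (sub-sem x C B) ]′ ⇆
    [ inj₁ ∘ from (sub-sem x C A) , inj₂ ∘ from (sub-sem x C B) ]′
  sub-sem x C (mod k A) =
    Modal-mono k (to (sub-sem x C A)) ⇆
    Modal-mono k (from (sub-sem x C A))
  sub-sem x C rec     = id ⇆ id
  sub-sem x C (con A) = sub-sem x C A
  sub-sem x C (fix ρ b) =
    FixedPoint-mono ρ (λ P⊆Q → sem-mono b P⊆Q ∘ to (sub-sem x C b)) ⇆
    FixedPoint-mono ρ (λ P⊆Q → from (sub-sem x C b) ∘ sem-mono b P⊆Q)

  plug-sem : ∀ {V} F (A : Flat r) → ⟦ plug F A ⟧ᶠ V ⇔₁ sem A V (⟦ F ⟧ᶠ V)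
  plug-sem F (lit l) = id ⇆ id
  plug-sem F (A ∧ B) =
    (λ (p , q) → to (plug-sem F A) p , to (plug-sem F B) q) ⇆
    (λ (p , q) → from (plug-sem F A) p , from (plug-sem F B) q)
  plug-sem F (A ∨ B) =
    [ inj₁ ∘ to (plug-sem F A) , inj₂ ∘ to (plug-sem F B) ]′ ⇆
    [ inj₁ ∘ from (plug-sem F A) , inj₂ ∘ from (plug-sem F B) ]′
  plug-sem F (mod k A) =
    Modal-mono k (to (plug-sem F A)) ⇆
    Modal-mono k (from (plug-sem F A))
  plug-sem F rec       = id ⇆ id
  plug-sem F (con A)   = id ⇆ id
  plug-sem F (fix ρ b) = id ⇆ id

-- Unfolding to skeletons, and the reflexive closure of accessibility.

module WeaklyTransitive {ℓ} (em : ExcludedMiddle ℓ) (M : Model ℓ) (wk4 : WK4 M) where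
  open Model M renaming (World to W)
  open FlatSemantics em M

  -- For `ν` the skeleton itself is the coinductive invariant, so unguarded occurrences of the
  -- variable may be taken as true; for `μ` falsum is below everything.
  skeleton-sound : ∀ (A : Flat r) l F {P V u} → ⟦ F ⟧ᶠ V ⊆ P → (litSem l V u → P u) →
                   ⟦ flatten (skeleton l F A) ⟧ᶠ V u → sem A V P u
  -- For `μ` one proves by induction that the fixed point lies in the skeleton. If the skeleton
  -- failed at the point, unguarded occurrences would be false there, which is just what `⊥ˡ`
  -- records.
  skeleton-complete : ∀ (A : Flat r) l F {P V u} → P ⊆ ⟦ F ⟧ᶠ V → (P u → litSem l V u) →
                      sem A V P u → ⟦ flatten (skeleton l F A) ⟧ᶠ V u

  skeleton-sound (lit l′)  l F F⊆ l⇒ p        = p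
  skeleton-sound (A ∧ B)   l F F⊆ l⇒ (p , q)  =
    skeleton-sound A l F F⊆ l⇒ p , skeleton-sound B l F F⊆ l⇒ q
  skeleton-sound (A ∨ B)   l F F⊆ l⇒ (inj₁ p) = inj₁ (skeleton-sound A l F F⊆ l⇒ p)
  skeleton-sound (A ∨ B)   l F F⊆ l⇒ (inj₂ q) = inj₂ (skeleton-sound B l F F⊆ l⇒ q)
  skeleton-sound (mod k A) l F F⊆ l⇒ p        =
    Modal-mono k (sem-mono A F⊆ ∘ to (plug-sem F A)) p
  skeleton-sound rec       l F F⊆ l⇒ p        = l⇒ p
  skeleton-sound (con A)   l F F⊆ l⇒ p        = sem-closed A (skeleton-sound A l F F⊆ l⇒ p)
  skeleton-sound (fix `μ b) l F F⊆ l⇒ p       =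
    μ-fold (sem-mono b) (skeleton-sound b ⊥ˡ (fix `μ b) id (λ ()) p)
  skeleton-sound (fix `ν b) l F {V = V} F⊆ l⇒ p =
    ν-coinduction-∪ {P = ⟦ flatten (skeleton ⊤ˡ (fix `ν b) b) ⟧ᶠ V} (sem-mono b)
      (λ q → inj₂ (skeleton-sound b ⊤ˡ (fix `ν b) inj₂ (λ _ → inj₁ q) q)) p

  skeleton-complete (lit l′)  l F ⊆F ⇒l p        = p
  skeleton-complete (A ∧ B)   l F ⊆F ⇒l (p , q)  =
    skeleton-complete A l F ⊆F ⇒l p , skeleton-complete B l F ⊆F ⇒l q
  skeleton-complete (A ∨ B)   l F ⊆F ⇒l (inj₁ p) = inj₁ (skeleton-complete A l F ⊆F ⇒l p)
  skeleton-complete (A ∨ B)   l F ⊆F ⇒l (inj₂ q) = inj₂ (skeleton-complete B l F ⊆F ⇒l q)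
  skeleton-complete (mod k A) l F ⊆F ⇒l p        =
    Modal-mono k (from (plug-sem F A) ∘ sem-mono A ⊆F) p
  skeleton-complete rec       l F ⊆F ⇒l p        = ⇒l p
  skeleton-complete (con A)   l F ⊆F ⇒l p        = skeleton-complete A l F ⊆F ⇒l (sem-closed A p)
  skeleton-complete (fix `ν b) l F ⊆F ⇒l p       =
    skeleton-complete b ⊤ˡ (fix `ν b) id (λ _ → tt) (ν-unfold (sem-mono b) p)
  skeleton-complete (fix `μ b) l F {V = V} ⊆F ⇒l p =
    proj₂ (μ-induction {P = λ w → ⟦ fix `μ b ⟧ᶠ V w × S w} (sem-mono b)
      (λ q → μ-fold (sem-mono b) (sem-mono b proj₁ q) ,
             stable (λ ¬s → ¬s (skeleton-complete b ⊥ˡ (fix `μ b) proj₁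
                                  (λ (_ , s) → contradiction s ¬s) q)))
      p)
    where S = ⟦ flatten (skeleton ⊥ˡ (fix `μ b) b) ⟧ᶠ V

  infix 4 _⊑_
  _⊑_ : W → W → Set ℓ
  v ⊑ u = v ≡ u ⊎ v ⊏ u

  ⊑-refl : ∀ {u} → u ⊑ u
  ⊑-refl = inj₁ refl

  -- The case `u ≡ w`, which weak transitivity leaves open, is absorbed by reflexivity.
  ⊑-trans : ∀ {u v w} → u ⊑ v → v ⊑ w → u ⊑ w
  ⊑-trans (inj₁ refl) v⊑w = v⊑w
  ⊑-trans (inj₂ u⊏v) (inj₁ refl) = inj₂ u⊏v
  ⊑-trans {u} {v} {w} (inj₂ u⊏v) (inj₂ v⊏w) with em {u ≡ w}
  ... | yes u≡w = inj₁ u≡w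
  ... | no u≢w  = inj₂ (wk4 u≢w u⊏v v⊏w)

  ⊑-up : ∀ {v} → UpClosed (v ⊑_)
  ⊑-up v⊑u u⊏u′ = ⊑-trans v⊑u (inj₂ u⊏u′)

  near⁺ : ∀ {P u v} → u ⊑ v → P v → Near P u
  near⁺ (inj₁ refl) p = inj₁ p
  near⁺ (inj₂ u⊏v)  p = inj₂ (_ , u⊏v , p)

  near⁻ : ∀ {P u} → Near P u → ∃[ v ] u ⊑ v × P v
  near⁻ (inj₁ p)           = _ , ⊑-refl , p
  near⁻ (inj₂ (v , R , p)) = v , inj₂ R , p

  near-mono : ∀ {P Q} → P ⊆ Q → Near P ⊆ Near Q
  near-mono P⊆Q = [ inj₁ ∘ P⊆Q , inj₂ ∘ Modal-mono poss P⊆Q ]′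

  near-down : ∀ {P u v} → u ⊑ v → Near P v → Near P u
  near-down u⊑v q = let w , v⊑w , p = near⁻ q in near⁺ (⊑-trans u⊑v v⊑w) p

  -- Stabilization of visibility inside a region.

  module Region (Z : Pred W ℓ) where

    -- A density notion on `Z`. It is closed under finite conjunctions, since the second witness can
    -- be sought above the first.
    record Eventually (P : Pred W ℓ) : Set ℓ where
      constructor mkEventually
      field
        cone : ∀ {w} → Z w → ∃[ v ] w ⊑ v × Z v × (∀ u → v ⊑ u → Z u → P u)
    open Eventually public

    always : ∀ {P : Pred W ℓ} → (∀ {u} → Z u → P u) → Eventually P
    always p = mkEventually λ Zw → _ , ⊑-refl , Zw , λ _ _ → p

    eventually-map : ∀ {P Q : Pred W ℓ} → Eventually P → (∀ u → Z u → P u → Q u) → Eventually Q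
    eventually-map evP f = mkEventually λ Zw → let v , w⊑v , Zv , p = cone evP Zw in
      v , w⊑v , Zv , λ u v⊑u Zu → f u Zu (p u v⊑u Zu)

    eventually-× : ∀ {P Q : Pred W ℓ} → Eventually P → Eventually Q → Eventually (λ u → P u × Q u)
    eventually-× evP evQ = mkEventually λ Zw →
      let v , w⊑v , Zv , p = cone evP Zw
          v′ , v⊑v′ , Zv′ , q = cone evQ Zv
      in v′ , ⊑-trans w⊑v v⊑v′ , Zv′ ,
         λ u v′⊑u Zu → p u (⊑-trans v⊑v′ v′⊑u) Zu , q u v′⊑u Zu

    eventually-≤ : ∀ {P : ℕ → Pred W ℓ} → (∀ k → Eventually (P k)) →
                   ∀ n → Eventually (λ u → ∀ k → k ≤ n → P k u)
    eventually-≤ ev zero    = eventually-map (ev 0) (λ { _ _ p zero z≤n → p })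
    eventually-≤ {P} ev (suc n) =
      eventually-map (eventually-× (eventually-≤ {P} ev n) (ev (suc n)))
        (λ _ _ (p , q) k k≤ →
          [ (λ { (s≤s k≤n) → p k k≤n }) , (λ { refl → q }) ]′ (m≤n⇒m<n∨m≡n k≤))

    eventually-All : ∀ {P : A → Pred W ℓ} → (∀ a → Eventually (P a)) →
                     ∀ as → Eventually (λ u → All (λ a → P a u) as)
    eventually-All ev []       = always (λ _ → [])
    eventually-All {P = P} ev (a ∷ as) =
      eventually-map (eventually-× (ev a) (eventually-All {P = P} ev as))
        (λ _ _ (p , ps) → p ∷ ps)

    Cluster : Pred W ℓ
    Cluster v = ∀ {u u′} → v ⊑ u → Z u → v ⊑ u′ → Z u′ → u ⊑ u′

    -- With `near-down` the first clause says that being seen is constant on the cone within `Z`.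
    -- The second confines any difference between `Near` and `Poss` to the case of one cluster.
    Settled : Pred W ℓ → Pred W ℓ
    Settled E v = (∀ {u} → v ⊑ u → Z u → Near E v → Near E u) ×
                  (Cluster v ⊎ (∀ {u} → v ⊑ u → Z u → Near E u → Poss E u))

    -- A point at which E holds but not at a successor is the only E-point above
    -- itself, so all points that still see E lie in its cluster.
    isolated⇒cluster : ∀ {E v} → (∀ {u} → v ⊑ u → Z u → Near E u) → ¬ Poss E v → Cluster v
    isolated⇒cluster {E} {v} sees ¬poss v⊑u Zu v⊑u′ _ =
      ⊑-trans (back v⊑u (near⁻ (sees v⊑u Zu))) v⊑u′
      where
      back : ∀ {u} → v ⊑ u → ∃[ t ] u ⊑ t × E t → u ⊑ v
      back v⊑u (t , u⊑t , e) with ⊑-trans v⊑u u⊑t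
      ... | inj₁ refl = u⊑t
      ... | inj₂ v⊏t  = contradiction (t , v⊏t , e) ¬poss

    -- Three cases: `E` is out of sight from some point on; or it always stays seen but some point
    -- has no successor in `E`, which forces a cluster; or every point has such a successor.
    eventually-settled : ∀ E → Eventually (Settled E)
    eventually-settled E = mkEventually settle
      where
      settle : ∀ {w} → Z w → ∃[ v ] w ⊑ v × Z v × (∀ u → v ⊑ u → Z u → Settled E u)
      settle {w} Zw with em {∃[ v ] w ⊑ v × Z v × ¬ Near E v}
      ... | yes (v , w⊑v , Zv , ¬near) = v , w⊑v , Zv , λ u v⊑u Zu →
            (λ _ _ near → contradiction (near-down v⊑u near) ¬near) ,
            inj₂ (λ u⊑t _ near → contradiction (near-down (⊑-trans v⊑u u⊑t) near) ¬near)
      ... | no never with em {∃[ v ] w ⊑ v × Z v × ¬ Poss E v}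
      ...   | yes (v , w⊑v , Zv , ¬poss) = v , w⊑v , Zv , λ u v⊑u Zu →
              (λ u⊑t Zt _ → sees (⊑-trans w⊑v (⊑-trans v⊑u u⊑t)) Zt) ,
              inj₁ (λ p Zp q Zq → isolated⇒cluster (λ v⊑t → sees (⊑-trans w⊑v v⊑t)) ¬poss
                                    (⊑-trans v⊑u p) Zp (⊑-trans v⊑u q) Zq)
            where
            sees : ∀ {u} → w ⊑ u → Z u → Near E u
            sees w⊑u Zu = stable (λ ¬near → never (_ , w⊑u , Zu , ¬near))
      ...   | no never′ = w , ⊑-refl , Zw , λ u w⊑u Zu →
              (λ u⊑t Zt _ → stable (λ ¬near → never (_ , ⊑-trans w⊑u u⊑t , Zt , ¬near))) ,
              inj₂ (λ u⊑t Zt _ → stable (λ ¬poss → never′ (_ , ⊑-trans w⊑u u⊑t , Zt , ¬poss)))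

    Somewhere Everywhere : W → Pred W ℓ → Set ℓ
    Somewhere v P = ∃[ u ] v ⊑ u × Z u × P u
    Everywhere v P = ∀ u → v ⊑ u → Z u → P u

    -- In a cluster where `Poss E` fails at `u`, every other point must see `E` through a successor,
    -- as its own membership in `E` would be visible from `u`. With `poss′` at `u` itself, `Poss E′`
    -- then holds everywhere, and `every` returns `Poss E` at `u`.
    same-extent : ∀ {E E′ v} → E ⊆ E′ → Settled E v →
      (Somewhere v (Poss E′) → Somewhere v (Poss E)) →
      (Everywhere v (Poss E′) → Everywhere v (Poss E)) →
      ∀ {u} → v ⊑ u → Z u → Poss E′ u → Poss E u
    same-extent {E} {E′} {v} E⊆E′ (const , shape) some every {u} v⊑u Zu poss′
      with some (u , v⊑u , Zu , poss′)
    ... | t , v⊑t , Zt , poss-t with shape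
    ...   | inj₂ visible = visible v⊑u Zu (const v⊑u Zu (near-down v⊑t (inj₂ poss-t)))
    ...   | inj₁ cluster = stable λ ¬poss →
              ¬poss (every (λ w v⊑w Zw → stable (λ ¬poss′ → refute ¬poss v⊑w Zw ¬poss′)) u v⊑u Zu)
      where
      near-all : ∀ {w} → v ⊑ w → Z w → Near E w
      near-all v⊑w Zw = const v⊑w Zw (near-down v⊑t (inj₂ poss-t))
      refute : ∀ {w} → ¬ Poss E u → v ⊑ w → Z w → ¬ ¬ Poss E′ w
      refute ¬poss v⊑w Zw ¬poss′ with near-all v⊑w Zw
      ... | inj₂ p = ¬poss′ (Modal-mono poss E⊆E′ p)
      ... | inj₁ e with cluster v⊑u Zu v⊑w Zw
      ...   | inj₁ refl = ¬poss′ poss′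
      ...   | inj₂ u⊏w  = ¬poss (_ , u⊏w , e)

    Monotonic : (ℕ → Pred W ℓ) → Set ℓ
    Monotonic E = (∀ k → E k ⊆ E (suc k)) ⊎ (∀ k → E (suc k) ⊆ E k)

    SameAt : (P Q : Pred W ℓ) → Pred W ℓ
    SameAt P Q u = (P u → Q u) × (Q u → P u)

    steady : ∀ (E : A → ℕ → Pred W ℓ) (as : List A) {v} → (∀ a → Monotonic (E a)) →
      (∀ k → k ≤ steps as → All (λ a → Settled (E a k) v) as) →
      ∃[ k ] suc k ≤ steps as ×
        All (λ a → ∀ u → v ⊑ u → Z u → SameAt (Poss (E a k)) (Poss (E a (suc k))) u) as
    steady {A = A} E as {v} monotonic settled =
      let k , _ , k< , same = unchanging as (flag Somewhere) (flag Everywhere)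
                                (antitone Somewhere some-mono) (antitone Everywhere every-mono) 0
      in k , k< , All.zipWith (λ {a} (((p , q) , sₖ) , sₖ₊₁) → extent a (monotonic a) p q sₖ sₖ₊₁)
           (All.zip (same , settled k (<⇒≤ k<)) , settled (suc k) k<)
      where
      flag′ : (W → Pred W ℓ → Set ℓ) → {E : ℕ → Pred W ℓ} → Monotonic E → ℕ → Set ℓ
      -- Increasing sequences are tracked through negated flags, so that all flags are antitone.
      flag′ F {E} (inj₁ _) k = ¬ F v (Poss (E k))
      flag′ F {E} (inj₂ _) k = F v (Poss (E k))
      flag : (W → Pred W ℓ → Set ℓ) → A → ℕ → Set ℓ
      flag F a = flag′ F (monotonic a)
      Preserved : (W → Pred W ℓ → Set ℓ) → Set (lsuc ℓ)
      Preserved F = ∀ {P Q} → P ⊆ Q → F v P → F v Q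
      some-mono : Preserved Somewhere
      some-mono P⊆Q (u , v⊑u , Zu , p) = u , v⊑u , Zu , P⊆Q p
      every-mono : Preserved Everywhere
      every-mono P⊆Q p u v⊑u Zu = P⊆Q (p u v⊑u Zu)
      antitone : ∀ F → Preserved F → ∀ a → Antitone (flag F a)
      antitone F pres a k with monotonic a
      ... | inj₁ up   = λ ¬p p → ¬p (pres (Modal-mono poss (up k)) p)
      ... | inj₂ down = pres (Modal-mono poss (down k))
      extent : ∀ a (m : Monotonic (E a)) {k} →
        (flag′ Somewhere m k → flag′ Somewhere m (suc k)) →
        (flag′ Everywhere m k → flag′ Everywhere m (suc k)) →
        Settled (E a k) v → Settled (E a (suc k)) v →
        ∀ u → v ⊑ u → Z u → SameAt (Poss (E a k)) (Poss (E a (suc k))) u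
      extent a (inj₁ up) {k} p q sₖ _ u v⊑u Zu =
        Modal-mono poss (up k) ,
        same-extent (up k) sₖ (λ h → stable (λ ¬h → p ¬h h)) (λ h → stable (λ ¬h → q ¬h h)) v⊑u Zu
      extent a (inj₂ down) {k} p q _ sₖ₊₁ u v⊑u Zu =
        same-extent (down k) sₖ₊₁ p q v⊑u Zu , Modal-mono poss (down k)

  -- Fixed points reached after boundedly many iterations.

  module SkeletonSemantics {L B : Set}
    (leafSem : L → Pred W ℓ → Pred W ℓ) (bodySem : B → Pred W ℓ → Pred W ℓ)
    (leaf-pointwise : ∀ l {Y Y′ u} → (Y u → Y′ u) → leafSem l Y u → leafSem l Y′ u)
    (body-local : ∀ b {D Y Y′} → UpClosed D → Y ⊆[ D ] Y′ → bodySem b Y ⊆[ D ] bodySem b Y′)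
    where

    ⟦_⟧ˢ : Skeleton L B → Pred W ℓ → Pred W ℓ
    ⟦ leaf l ⟧ˢ  Y   = leafSem l Y
    ⟦ s ∧ t ⟧ˢ   Y u = ⟦ s ⟧ˢ Y u × ⟦ t ⟧ˢ Y u
    ⟦ s ∨ t ⟧ˢ   Y u = ⟦ s ⟧ˢ Y u ⊎ ⟦ t ⟧ˢ Y u
    ⟦ mod k b ⟧ˢ Y   = Modal k (bodySem b Y)

    -- The set whose visibility decides the modal formula.
    witnesses : Mode × B → Pred W ℓ → Pred W ℓ
    witnesses (poss , b) Y   = bodySem b Y
    witnesses (nec  , b) Y u = ¬ bodySem b Y u

    ˢ-local : ∀ s {D Y Y′} → UpClosed D → Y ⊆[ D ] Y′ → ⟦ s ⟧ˢ Y ⊆[ D ] ⟦ s ⟧ˢ Y′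
    ˢ-local (leaf l)  up Y⊆ d p        = leaf-pointwise l (Y⊆ d) p
    ˢ-local (s ∧ t)   up Y⊆ d (p , q)  = ˢ-local s up Y⊆ d p , ˢ-local t up Y⊆ d q
    ˢ-local (s ∨ t)   up Y⊆ d (inj₁ p) = inj₁ (ˢ-local s up Y⊆ d p)
    ˢ-local (s ∨ t)   up Y⊆ d (inj₂ q) = inj₂ (ˢ-local t up Y⊆ d q)
    ˢ-local (mod k b) {D} up Y⊆ d p    = Modal-local {D} k up (body-local b up Y⊆) d p

    ˢ-mono : ∀ s {Y Y′} → Y ⊆ Y′ → ⟦ s ⟧ˢ Y ⊆ ⟦ s ⟧ˢ Y′
    ˢ-mono s Y⊆Y′ = ˢ-local s {All-worlds} (λ _ _ → tt) (λ _ → Y⊆Y′) tt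

    body-mono : ∀ b {Y Y′} → Y ⊆ Y′ → bodySem b Y ⊆ bodySem b Y′
    body-mono b Y⊆Y′ = body-local b {All-worlds} (λ _ _ → tt) (λ _ → Y⊆Y′) tt

    SameModals : Skeleton L B → (Y Y′ : Pred W ℓ) → Pred W ℓ
    SameModals s Y Y′ u =
      All (λ a → (Poss (witnesses a Y) u → Poss (witnesses a Y′) u) ×
                 (Poss (witnesses a Y′) u → Poss (witnesses a Y) u)) (modals s)

    -- Unguarded leaves use the implication at `u`, modal atoms only the visibility of their
    -- witnesses from `u`; nothing is asked of `Y` and `Y′` pointwise elsewhere.
    transfer : ∀ s {Y Y′ u} → SameModals s Y Y′ u → (Y u → Y′ u) → ⟦ s ⟧ˢ Y u → ⟦ s ⟧ˢ Y′ u
    transfer (leaf l) _ Y⇒ p = leaf-pointwise l Y⇒ p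
    transfer (s ∧ t) same Y⇒ (p , q) = let ss , st = ++⁻ (modals s) same in
      transfer s ss Y⇒ p , transfer t st Y⇒ q
    transfer (s ∨ t) same Y⇒ (inj₁ p) = inj₁ (transfer s (proj₁ (++⁻ (modals s) same)) Y⇒ p)
    transfer (s ∨ t) same Y⇒ (inj₂ q) = inj₂ (transfer t (proj₂ (++⁻ (modals s) same)) Y⇒ q)
    transfer (mod poss b) ((f , _) ∷ []) Y⇒ p = f p
    transfer (mod nec b)  ((_ , g) ∷ []) Y⇒ p v R = stable λ ¬q →
      let v′ , R′ , ¬q′ = g (v , R , ¬q) in ¬q′ (p v′ R′)

    module Settling (Z : Pred W ℓ) where
      open Region Z

      SettledModals : Skeleton L B → (ℕ → Pred W ℓ) → Pred W ℓ
      SettledModals s Y v =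
        ∀ k → k ≤ steps (modals s) → All (λ a → Settled (witnesses a (Y k)) v) (modals s)

      witnesses-monotonic : ∀ {Y} → Monotonic Y → ∀ a → Monotonic (λ k → witnesses a (Y k))
      witnesses-monotonic (inj₁ up)   (poss , b) = inj₁ (λ k → body-mono b (up k))
      witnesses-monotonic (inj₂ down) (poss , b) = inj₂ (λ k → body-mono b (down k))
      witnesses-monotonic (inj₁ up)   (nec  , b) = inj₂ (λ k ¬p p → ¬p (body-mono b (up k) p))
      witnesses-monotonic (inj₂ down) (nec  , b) = inj₁ (λ k ¬p p → ¬p (body-mono b (down k) p))

      steady-modals : ∀ s {Y v} → Monotonic Y → SettledModals s Y v →
        ∃[ k ] suc k ≤ steps (modals s) ×
          (∀ {u} → v ⊑ u → Z u → SameModals s (Y k) (Y (suc k)) u)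
      steady-modals s {Y} mono settled =
        let k , k< , same = steady (λ a k → witnesses a (Y k)) (modals s)
                                   (witnesses-monotonic mono) settled
        in k , k< , λ v⊑u Zu → All.map (λ f → f _ v⊑u Zu) same

      -- A sequence approximating a greatest fixed point X from above reaches it
      -- on the cone of v, since there it becomes a postfixed point.
      ν-settles : ∀ s {X : Pred W ℓ} {Y : ℕ → Pred W ℓ} {v} →
        (∀ {P : Pred W ℓ} → (∀ {u} → P u → X u ⊎ ⟦ s ⟧ˢ (λ t → P t ⊎ X t) u) → P ⊆ X) →
        (∀ k → Y (suc k) ⊆ Y k) →
        (∀ {u} → v ⊑ u → ¬ Z u → Y 0 u → X u) →
        (∀ {k u} → k ≤ steps (modals s) → v ⊑ u → Z u → Y (suc k) u → X u ⊎ ⟦ s ⟧ˢ (Y k) u) →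
        SettledModals s Y v →
        ∀ {u} → v ⊑ u → Y (steps (modals s)) u → X u
      ν-settles s {X} {Y} {v} coind down outside step settled v⊑u y =
        let k , k< , same = steady-modals s (inj₂ down) settled in
        coind {λ u → v ⊑ u × Y (suc k) u}
          (λ {u} (v⊑u , y) → case em {Z u} of λ where
            (no ¬Zu) → inj₁ (outside v⊑u ¬Zu (descend z≤n y))
            (yes Zu) → [ inj₁ , (λ p → inj₂
              (ˢ-local s {v ⊑_} ⊑-up (λ v⊑t y′ → inj₁ (v⊑t , y′)) v⊑u
                (transfer s (same v⊑u Zu) (λ _ → y) p))) ]′ (step (<⇒≤ k<) v⊑u Zu y))
          (v⊑u , descend k< y)
        where
        descend : ∀ {k l u} → k ≤ l → Y l u → Y k u
        descend {u = u} = antitone-≤ {λ k → Y k u} (λ k → down k)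

      -- At the steady index, `Y (suc k)` is prefixed on the cone. Carrying leaves back from
      -- `Y (suc k)` to `Y k` is possible because one may assume that `Y (suc k)` fails at the point
      -- in question.
      μ-settles : ∀ s {X : Pred W ℓ} {Y : ℕ → Pred W ℓ} {v} →
        (∀ {P : Pred W ℓ} → ⟦ s ⟧ˢ P ⊆ P → X ⊆ P) →
        (∀ k → Y k ⊆ Y (suc k)) →
        (∀ {k u} → v ⊑ u → ¬ Z u → ⟦ s ⟧ˢ (Y k) u → Y k u) →
        (∀ {k u} → k ≤ steps (modals s) → v ⊑ u → Z u → ⟦ s ⟧ˢ (Y k) u → Y (suc k) u) →
        SettledModals s Y v →
        ∀ {u} → v ⊑ u → X u → Y (steps (modals s)) u
      μ-settles s {X} {Y} {v} ind up outside step settled v⊑u x =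
        let k , k< , same = steady-modals s (inj₁ up) settled in
        ascend k< (ind {λ u → v ⊑ u → Y (suc k) u}
          (λ {u} p v⊑u → let p′ = ˢ-local s {v ⊑_} ⊑-up (λ v⊑t y → y v⊑t) v⊑u p in
            case em {Z u} of λ where
              (no ¬Zu) → outside v⊑u ¬Zu p′
              (yes Zu) → stable λ ¬y → ¬y (step (<⇒≤ k<) v⊑u Zu
                (transfer s (All.map (λ (f , g) → g , f) (same v⊑u Zu)) (λ y → contradiction y ¬y) p′)))
          x v⊑u)
        where
        ascend : ∀ {k l u} → k ≤ l → Y k u → Y l u
        ascend {k} {zero}  z≤n y = y
        ascend {k} {suc l} k≤l y with m≤n⇒m<n∨m≡n k≤l
        ... | inj₁ (s≤s k≤l′) = up l (ascend k≤l′ y)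
        ... | inj₂ refl       = y

-- Correctness of the fixpoint-free approximations.

module Approximation {ℓ} (em : ExcludedMiddle ℓ) (M : Model ℓ) (wk4 : WK4 M) where
  open Model M renaming (World to W)
  open FlatSemantics em M
  open WeaklyTransitive em M wk4

  module BodySkeleton (V : Env) where

    leafSem : Maybe (Flat false) → Pred W ℓ → Pred W ℓ
    leafSem nothing  Y = Y
    leafSem (just A) Y = ⟦ A ⟧ᶠ V

    leaf-pointwise : ∀ l {Y Y′ u} → (Y u → Y′ u) → leafSem l Y u → leafSem l Y′ u
    leaf-pointwise nothing  Y⇒ p = Y⇒ p
    leaf-pointwise (just A) Y⇒ p = p

    open SkeletonSemantics leafSem (λ (b : Flat true) → sem b V) leaf-pointwise
      (λ b {D} up → sem-local {D = D} up (λ _ _ p → p) b) public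

    bodySkeleton-sem : ∀ b {Y} → ⟦ bodySkeleton b ⟧ˢ Y ⇔₁ sem b V Y
    bodySkeleton-sem (lit l) = id ⇆ id
    bodySkeleton-sem (b ∧ c) =
      (λ (p , q) → to (bodySkeleton-sem b) p , to (bodySkeleton-sem c) q) ⇆
      (λ (p , q) → from (bodySkeleton-sem b) p , from (bodySkeleton-sem c) q)
    bodySkeleton-sem (b ∨ c) =
      [ inj₁ ∘ to (bodySkeleton-sem b) , inj₂ ∘ to (bodySkeleton-sem c) ]′ ⇆
      [ inj₁ ∘ from (bodySkeleton-sem b) , inj₂ ∘ from (bodySkeleton-sem c) ]′
    bodySkeleton-sem (mod k b) = id ⇆ id
    bodySkeleton-sem rec       = id ⇆ id
    bodySkeleton-sem (con A)   = id ⇆ id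

  module HatSound (Z : Pred W ℓ) (V : Env) (x : Var) (lo : Flat false) (e : Flat true)
                  (lo⊆e : ⟦ lo ⟧ᶠ V ⊆ sem e V Z) where
    open Region Z

    V′ : Env
    V′ = V [ x ≔ sem e V Z ]

    Sound : Flat r → Flat true → Pred W ℓ
    Sound b Y v = ∀ {u} → v ⊑ u → sem (hat x lo e b Y) V Z u → sem b V′ (sem Y V Z) u

    base-sound : ∀ ρ b {Y} → sem (con (sub x lo (fix ρ b))) V Y ⊆ sem (fix ρ b) V′ Y
    base-sound ρ b = subst-mono lo⊆e (fix ρ b) {Empty} ∘ to (sub-sem x lo (fix ρ b) {Empty})

    -- A `μ`-chain lies below the least fixed point at every stage. Only a `ν`-chain has to settle,
    -- and `ν-settles` makes it postfixed up to the fixed point.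
    hat-sound : (b : Flat r) (Y : Flat true) → Eventually (Sound b Y)
    hat-sound {r} (lit l) Y =
      always {Sound (lit {r} l) Y} (λ _ _ p → to (litSub-sem x e l {Z} {Z}) p)
    hat-sound (A ∧ B) Y = eventually-map (eventually-× (hat-sound A Y) (hat-sound B Y))
      (λ _ _ (f , g) v⊑u (p , q) → f v⊑u p , g v⊑u q)
    hat-sound (A ∨ B) Y = eventually-map (eventually-× (hat-sound A Y) (hat-sound B Y))
      (λ _ _ (f , g) v⊑u → [ inj₁ ∘ f v⊑u , inj₂ ∘ g v⊑u ]′)
    hat-sound (mod k A) Y = eventually-map (hat-sound A Y)
      (λ v _ f v⊑u → Modal-local {v ⊑_} k ⊑-up f v⊑u)
    hat-sound rec Y = always (λ _ _ p → p)
    hat-sound (con A) Y = eventually-map (hat-sound A Y)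
      (λ _ _ f v⊑u p → sem-closed A (f v⊑u p))
    hat-sound (fix `μ b) Y = eventually-map (eventually-≤ (λ k → hat-sound b (C k)) n)
      (λ _ _ f v⊑u → below f n ≤-refl v⊑u)
      where
      n = steps (modals (bodySkeleton b))
      C = chain `μ (con (sub x lo (fix `μ b))) (hat x lo e b)
      below : ∀ {v} → (∀ k → k ≤ n → Sound b (C k) v) →
              ∀ k → k ≤ n → sem (C k) V Z ⊆[ v ⊑_ ] sem (fix `μ b) V′ Empty
      below f zero    _   v⊑u p              = base-sound `μ b {Z} p
      below f (suc k) k<n v⊑u (inj₁ p)       = below f k (<⇒≤ k<n) v⊑u p
      below {v} f (suc k) k<n v⊑u (inj₂ (_ , p)) = μ-fold (sem-mono b)
        (sem-local {D = v ⊑_} ⊑-up (λ _ _ q → q) b (below f k (<⇒≤ k<n)) v⊑u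
          (f k (<⇒≤ k<n) v⊑u p))
    hat-sound (fix `ν b) Y = eventually-map
      (eventually-× (eventually-≤ (λ k → hat-sound b (C k)) (steps (modals s)))
        (eventually-≤ (λ k → eventually-All (λ a → eventually-settled (witnesses a (sem (C k) V Z)))
                                            (modals s)) (steps (modals s))))
      (λ _ _ (f , settled) v⊑u → ν-settles s {Y = λ k → sem (C k) V Z}
        (λ step → ν-coinduction-∪ (sem-mono b)
          ([ inj₁ , inj₂ ∘ to (bodySkeleton-sem b) ]′ ∘ step))
        down
        (λ { _ ¬Zu (inj₁ p) → base-sound `ν b {Z} p ; _ ¬Zu (inj₂ Zu) → contradiction Zu ¬Zu })
        (λ { k≤n v⊑t _ (inj₁ p) → inj₁ (base-sound `ν b {Z} p)
           ; k≤n v⊑t _ (inj₂ (_ , _ , p)) → inj₂ (from (bodySkeleton-sem b) (f _ k≤n v⊑t p)) })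
        settled v⊑u)
      where
      open BodySkeleton V′
      open Settling Z
      s = bodySkeleton b
      C = chain `ν (con (sub x lo (fix `ν b))) (hat x lo e b)
      down : ∀ k → sem (C (suc k)) V Z ⊆ sem (C k) V Z
      down zero    (inj₁ p)           = inj₁ p
      down (suc k) (inj₁ p)           = inj₁ p
      down k       (inj₂ (_ , p , _)) = p

  module HatComplete (Z : Pred W ℓ) (V : Env) (x : Var) (lo : Flat false) (X : Pred W ℓ)
    (lo⊆X : ⟦ lo ⟧ᶠ V ⊆ X)
    (low : ∀ {v u} → Z v → v ⊑ u → ¬ Z u → X u → ⟦ lo ⟧ᶠ V u)
    (leave : ∀ {v u t} → Z v → v ⊑ u → ¬ Z u → u ⊑ t → ¬ Z t) where
    open Region Z

    V′ : Env
    V′ = V [ x ≔ X ]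

    Covers : Flat true → Pred W ℓ
    Covers e v = ∀ {u} → v ⊑ u → X u → sem e V Z u

    Complete : Flat true → Flat r → Flat true → Pred W ℓ
    Complete e b Y v = ∀ {u} → v ⊑ u → sem b V′ (sem Y V Z) u → sem (hat x lo e b Y) V Z u

    base-sound : ∀ ρ b {Y} → sem (con (sub x lo (fix ρ b))) V Y ⊆ sem (fix ρ b) V′ Y
    base-sound ρ b = subst-mono lo⊆X (fix ρ b) {Empty} ∘ to (sub-sem x lo (fix ρ b) {Empty})

    -- Once `Z` has been left, the whole cone avoids it, so `X` may be replaced by `lo` throughout
    -- that cone.
    base-complete : ∀ ρ b {Y v u} → Z v → v ⊑ u → ¬ Z u →
                    sem (fix ρ b) V′ Y u → sem (con (sub x lo (fix ρ b))) V Y u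
    base-complete ρ b {u = u} Zv v⊑u ¬Zu p = from (sub-sem x lo (fix ρ b) {Empty})
      (subst-local {D = u ⊑_} ⊑-up
        (λ u⊑t → low Zv (⊑-trans v⊑u u⊑t) (leave Zv v⊑u ¬Zu u⊑t))
        (fix ρ b) {Empty} {Empty} (λ _ p → p) ⊑-refl p)

    module _ (e : Flat true) (covers : Eventually (Covers e)) where

      -- Dual to soundness: `ν`-chains stay above the greatest fixed point by themselves, while
      -- `μ`-chains rely on `μ-settles`.
      hat-complete : (b : Flat r) (Y : Flat true) → Eventually (Complete e b Y)
      hat-complete {r} (lit l) Y = eventually-map covers
        (λ v _ f v⊑u p → from (litSub-sem x e l {Z} {Empty})
          (subst-local {D = v ⊑_} ⊑-up f (lit {r} l) {Empty} {Empty} (λ _ p → p) v⊑u p))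
      hat-complete (A ∧ B) Y = eventually-map (eventually-× (hat-complete A Y) (hat-complete B Y))
        (λ _ _ (f , g) v⊑u (p , q) → f v⊑u p , g v⊑u q)
      hat-complete (A ∨ B) Y = eventually-map (eventually-× (hat-complete A Y) (hat-complete B Y))
        (λ _ _ (f , g) v⊑u → [ inj₁ ∘ f v⊑u , inj₂ ∘ g v⊑u ]′)
      hat-complete (mod k A) Y = eventually-map (hat-complete A Y)
        (λ v _ f v⊑u → Modal-local {v ⊑_} k ⊑-up f v⊑u)
      hat-complete rec Y = always (λ _ _ p → p)
      hat-complete (con A) Y = eventually-map (hat-complete A Y)
        (λ _ _ f v⊑u p → f v⊑u (sem-closed A p))
      hat-complete (fix `ν b) Y = eventually-map (eventually-≤ (λ k → hat-complete b (C k)) n)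
        (λ _ Zv f v⊑u p → above Zv f n ≤-refl v⊑u p)
        where
        n = steps (modals (bodySkeleton b))
        C = chain `ν (con (sub x lo (fix `ν b))) (hat x lo e b)
        above : ∀ {v} → Z v → (∀ k → k ≤ n → Complete e b (C k) v) →
                ∀ k → k ≤ n → sem (fix `ν b) V′ Empty ⊆[ v ⊑_ ] sem (C k) V Z
        above {v} Zv f k k≤n {u} v⊑u p with em {Z u}
        above {v} Zv f zero    k≤n {u} v⊑u p | no ¬Zu = inj₁ (base-complete `ν b {Empty} Zv v⊑u ¬Zu p)
        above {v} Zv f (suc k) k≤n {u} v⊑u p | no ¬Zu = inj₁ (base-complete `ν b {Empty} Zv v⊑u ¬Zu p)
        above {v} Zv f zero    k≤n {u} v⊑u p | yes Zu = inj₂ Zu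
        above {v} Zv f (suc k) k<n {u} v⊑u p | yes Zu =
          inj₂ (Zu , above Zv f k (<⇒≤ k<n) v⊑u p , f k (<⇒≤ k<n) v⊑u
            (sem-local {D = v ⊑_} ⊑-up (λ _ _ q → q) b (above Zv f k (<⇒≤ k<n)) v⊑u
              (ν-unfold (sem-mono b) p)))
      hat-complete (fix `μ b) Y = eventually-map
        (eventually-× (eventually-≤ (λ k → hat-complete b (C k)) (steps (modals s)))
          (eventually-≤ (λ k → eventually-All (λ a → eventually-settled (witnesses a (sem (C k) V Z)))
                                              (modals s)) (steps (modals s))))
        (λ _ Zv (f , settled) v⊑u → μ-settles s {Y = λ k → sem (C k) V Z}
          (λ pre → μ-induction (sem-mono b) (pre ∘ from (bodySkeleton-sem b)))
          (λ _ → inj₁)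
          -- Off `Z` the chain collapses to its base, which there equals the true least fixed point
          -- and is therefore prefixed.
          (λ {k} {u} v⊑u ¬Zu p → base⊆ k (base-complete `μ b {Empty} Zv v⊑u ¬Zu
            (μ-fold (sem-mono b) (sem-local {D = u ⊑_} ⊑-up (λ _ _ q → q) b
              (λ u⊑t q → base-sound `μ b {Empty} (outside k (leave Zv v⊑u ¬Zu u⊑t) q)) ⊑-refl
              (to (bodySkeleton-sem b) p)))))
          (λ k≤n v⊑u Zu p → inj₂ (Zu , f _ k≤n v⊑u (to (bodySkeleton-sem b) p)))
          settled v⊑u)
        where
        open BodySkeleton V′
        open Settling Z
        s = bodySkeleton b
        base = con (sub x lo (fix `μ b))
        C = chain `μ base (hat x lo e b)
        base⊆ : ∀ k → sem base V Z ⊆ sem (C k) V Z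
        base⊆ zero    p = p
        base⊆ (suc k) p = inj₁ (base⊆ k p)
        outside : ∀ k {t} → ¬ Z t → sem (C k) V Z t → sem base V Z t
        outside zero    ¬Zt p               = p
        outside (suc k) ¬Zt (inj₁ p)        = outside k ¬Zt p
        outside (suc k) ¬Zt (inj₂ (Zt , _)) = contradiction Zt ¬Zt

steps-suc : (as : List A) → ∃[ m ] steps as ≡ suc m
steps-suc []       = 0 , refl
steps-suc (_ ∷ as) with steps as | steps-suc as
... | _ | m , refl = _ , refl

+-≤-split : ∀ {a b a′ b′} → a′ ≤ a → b′ ≤ b → a + b ≤ a′ + b′ → a ≤ a′ × b ≤ b′
+-≤-split {a} {b} {a′} {b′} a′≤a b′≤b sum =
  +-cancelʳ-≤ b a a′ (≤-trans sum (+-monoʳ-≤ a′ b′≤b)) ,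
  +-cancelˡ-≤ a b b′ (≤-trans sum (+-monoˡ-≤ b′ a′≤a))

-- Correctness of the solution in a fixed model.

module Solution {ℓ} (em : ExcludedMiddle ℓ) (M : Model ℓ) (wk4 : WK4 M)
                (x : Var) (s : Skeleton Lit (Flat false))
                (V : FlatSemantics.Env em M) where
  open Model M renaming (World to W)
  open FlatSemantics em M
  open WeaklyTransitive em M wk4
  open Approximation em M wk4
  open Elimination x s

  open SkeletonSemantics (λ l Y → litSem l (V [ x ≔ Y ])) (λ A Y → ⟦ A ⟧ᶠ (V [ x ≔ Y ]))
    (λ l Y⇒ → lit-pointwise l Y⇒)
    (λ A {D} up Y⊆ → subst-local {D = D} up Y⊆ A {Empty} {Empty} (λ _ p → p))
    public

  flatten-sem : ∀ t {Y} → ⟦ flatten t ⟧ᶠ (V [ x ≔ Y ]) ⇔₁ ⟦ t ⟧ˢ Y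
  flatten-sem (leaf l) = id ⇆ id
  flatten-sem (t ∧ u) =
    (λ (p , q) → to (flatten-sem t) p , to (flatten-sem u) q) ⇆
    (λ (p , q) → from (flatten-sem t) p , from (flatten-sem u) q)
  flatten-sem (t ∨ u) =
    [ inj₁ ∘ to (flatten-sem t) , inj₂ ∘ to (flatten-sem u) ]′ ⇆
    [ inj₁ ∘ from (flatten-sem t) , inj₂ ∘ from (flatten-sem u) ]′
  flatten-sem (mod k A) = id ⇆ id

  X : Pred W ℓ
  X = FixedPoint `ν ⟦ s ⟧ˢ

  Visible : (Flat false → Pred W ℓ) → W → Mode × Flat false → Set ℓ
  Visible f w (poss , A) = Near (f A) w
  Visible f w (nec  , A) = ⊤

  persist-sem : ∀ h as {Y} →
    sem (persist h as) V Y ⇔₁ (λ w → All (Visible (λ A → sem (h A) V Y) w) as)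
  persist-sem h [] = (λ _ → []) ⇆ (λ _ → tt)
  persist-sem h ((poss , A) ∷ as) =
    (λ (p , ps) → p ∷ to (persist-sem h as) ps) ⇆ (λ { (p ∷ ps) → p , from (persist-sem h as) ps })
  persist-sem h ((nec , A) ∷ as) =
    (λ ps → tt ∷ to (persist-sem h as) ps) ⇆ (λ { (_ ∷ ps) → from (persist-sem h as) ps })

  visible-map : ∀ {f g w v} → (∀ A → Near (f A) w → Near (g A) v) →
                ∀ a → Visible f w a → Visible g v a
  visible-map F (poss , A) = F A
  visible-map F (nec  , A) = id

  Kill : Skeleton Lit (Flat false) → Skeleton Lit (Flat false) → Set (lsuc ℓ)
  Kill t u = ∀ {Y} → ⟦ t ⟧ˢ Y ⊆ ⟦ u ⟧ˢ Y

  kills-sound : ∀ u {t} → t ∈ kills u → Kill t u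
  kills-sound (leaf l) (here refl) p = p
  kills-sound (u ∧ u′) t∈ with ∈-cartesianProductWith⁻ _∧_ (kills u) (kills u′) t∈
  ... | _ , _ , t∈u , t∈u′ , refl = λ (p , q) → kills-sound u t∈u p , kills-sound u′ t∈u′ q
  kills-sound (u ∨ u′) t∈ with ∈-cartesianProductWith⁻ _∨_ (kills u) (kills u′) t∈
  ... | _ , _ , t∈u , t∈u′ , refl =
        [ inj₁ ∘ kills-sound u t∈u , inj₂ ∘ kills-sound u′ t∈u′ ]′
  kills-sound (mod poss A) (here refl)         ()
  kills-sound (mod poss A) (there (here refl)) p = p
  kills-sound (mod nec A)  (here refl)         p = p

  -- Soundness of a single stage.

  module StageSound (lo : Flat false) (lo⊆X : ⟦ lo ⟧ᶠ V ⊆ X)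
                    (t : Skeleton Lit (Flat false)) (kill : Kill t s) where

    n : ℕ
    n = steps (modals t)

    t-coinduction : ∀ {P : Pred W ℓ} →
      (∀ {u} → P u → X u ⊎ ⟦ t ⟧ˢ (λ w → P w ⊎ X w) u) → P ⊆ X
    t-coinduction step = ν-coinduction-∪ (ˢ-mono s) ([ inj₁ , inj₂ ∘ kill ]′ ∘ step)

    D : Pred W ℓ
    D = ⟦ region lo t ⟧ᶠ V

    -- Climb to a settled point of `Z` above `w`. There the approximants lie inside `X`, so a
    -- diamond body that is approximately seen is really seen, and visibility passes down to `w`.
    region-sound : ∀ {w} → D w → All (Visible (λ A → ⟦ A ⟧ᶠ (V [ x ≔ X ])) w) (modals t)
    region-sound near-w =
      let w′ , w⊑w′ , Zw′ = near⁻ near-w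
          v , w′⊑v , Zv , stable-v = cone
            (eventually-× (eventually-≤
                             (λ k → HatSound.hat-sound Z V x lo (C k) (lo⊆C k) (flatten t) rec) n)
            (eventually-× (eventually-≤ (λ k → eventually-All
                             (λ a → eventually-settled (witnesses a (sem (C k) V Z))) (modals t)) n)
                          (eventually-All (λ (_ , A) → HatSound.hat-sound Z V x lo (C n) (lo⊆C n) A rec)
                                          (modals t)))) Zw′
          sound , settled , sound-modals = stable-v v ⊑-refl Zv
          C⊆X = λ {u} → ν-settles t {Y = λ k → sem (C k) V Z} t-coinduction down
            (λ { _ ¬Zu (inj₁ p) → lo⊆X p ; _ ¬Zu (inj₂ Zu) → contradiction Zu ¬Zu })
            (λ { k≤n v⊑u _ (inj₁ p) → inj₁ (lo⊆X p)
               ; k≤n v⊑u _ (inj₂ (_ , _ , p)) →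
                   inj₂ (to (flatten-sem t) (sem-closed (flatten t) (sound _ k≤n v⊑u p))) })
            settled {u}
      in All.zipWith {P = λ a → HatSound.Sound Z V x lo (C n) (lo⊆C n) (proj₂ a) rec v}
        (λ {a} (f , vis) → visible-step v (⊑-trans w⊑w′ w′⊑v) C⊆X a f vis)
        (sound-modals , to (persist-sem _ (modals t)) (ν-unfold (sem-mono (persistence lo t)) Zv))
      where
      Z = ⟦ fix `ν (persistence lo t) ⟧ᶠ V
      C = inner lo t
      open Region Z
      open Settling Z
      lo⊆C : ∀ k → ⟦ lo ⟧ᶠ V ⊆ sem (C k) V Z
      lo⊆C zero    = inj₁
      lo⊆C (suc k) = inj₁
      down : ∀ k → sem (C (suc k)) V Z ⊆ sem (C k) V Z
      down zero    (inj₁ p)           = inj₁ p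
      down (suc k) (inj₁ p)           = inj₁ p
      down k       (inj₂ (_ , p , _)) = p
      visible-step : ∀ {w} v → w ⊑ v → sem (C n) V Z ⊆[ v ⊑_ ] X → ∀ a →
        HatSound.Sound Z V x lo (C n) (lo⊆C n) (proj₂ a) rec v →
        Visible (λ A → sem (hat x lo (C n) A rec) V Z) v a →
        Visible (λ A → ⟦ A ⟧ᶠ (V [ x ≔ X ])) w a
      visible-step v w⊑v C⊆X (nec  , A) f vis = tt
      visible-step v w⊑v C⊆X (poss , A) f vis =
        let u , v⊑u , p = near⁻ vis in
        near⁺ (⊑-trans w⊑v v⊑u)
          (subst-local {D = v ⊑_} ⊑-up C⊆X A {Empty} (λ _ q → q) v⊑u (sem-closed A (f v⊑u p)))

    -- `X` is adjoined so that a diamond body seen under `X` is seen at every level of the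
    -- iteration.
    Ξ : ℕ → Pred W ℓ
    Ξ k u = X u ⊎ ⟦ outer lo t k ⟧ᶠ V u

    Ξ-down : ∀ k → Ξ (suc k) ⊆ Ξ k
    Ξ-down k (inj₁ p) = inj₁ p
    Ξ-down k (inj₂ (inj₁ p)) = inj₁ (lo⊆X p)
    Ξ-down k (inj₂ (inj₂ (_ , p , _))) = inj₂ p

    Ξ-descend : ∀ {k l} → k ≤ l → Ξ l ⊆ Ξ k
    Ξ-descend k≤l {u} = antitone-≤ {λ k → Ξ k u} (λ k → Ξ-down k) k≤l

    Ξ-unfold : ∀ k {u} → Ξ (suc k) u → X u ⊎ ⟦ t ⟧ˢ (Ξ k) u
    Ξ-unfold k (inj₁ p)        = inj₁ p
    Ξ-unfold k (inj₂ (inj₁ p)) = inj₁ (lo⊆X p)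
    Ξ-unfold k (inj₂ (inj₂ (_ , _ , p))) = inj₂
      (ˢ-mono t inj₂ (to (flatten-sem t) (to (sub-sem x (outer lo t k) (flatten t) {Empty}) p)))

    Ξ-outside : ∀ k {u} → ¬ D u → Ξ k u → X u
    Ξ-outside k       ¬Du (inj₁ p)               = p
    Ξ-outside zero    ¬Du (inj₂ (inj₁ p))        = lo⊆X p
    Ξ-outside zero    ¬Du (inj₂ (inj₂ d))        = contradiction d ¬Du
    Ξ-outside (suc k) ¬Du (inj₂ (inj₁ p))        = lo⊆X p
    Ξ-outside (suc k) ¬Du (inj₂ (inj₂ (d , _)))  = contradiction d ¬Du

    seen : ℕ → W → Mode × Flat false → Set ℓ
    seen k u a = Near (witnesses a (Ξ k)) u

    -- Within `D` the diamonds are seen at all levels by `region-sound`, and counterexamples to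
    -- boxes accumulate as `Ξ` shrinks.
    seen-mono : ∀ {k l u} → D u → k ≤ l → All (λ a → seen k u a → seen l u a) (modals t)
    seen-mono {k} {l} {u} d k≤l = All.map (λ {a} → step a) (region-sound d)
      where
      step : ∀ a → Visible (λ A → ⟦ A ⟧ᶠ (V [ x ≔ X ])) u a → seen k u a → seen l u a
      step (poss , A) vis _ = near-mono (body-mono A inj₁) vis
      step (nec  , A) _     = near-mono (λ ¬p p → ¬p (body-mono A (Ξ-descend k≤l) p))

    -- Induction on the number of modal atoms whose witnesses are seen.  If it is
    -- the same at two levels, the part of the cone of v that has not been dealt
    -- with by induction is stable between the two levels.
    sound-at : ∀ m {v} → D v → count (seen (m * n) v) (modals t) < m → Ξ (m * n) v → X v
    sound-at (suc m) {v} Dv few p with m ≤? count (seen (m * n) v) (modals t)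
    ... | no  m≰ = sound-at m Dv (≰⇒> m≰) (Ξ-descend (m≤n+m (m * n) n) p)
    ... | yes m≤ = t-coinduction {λ u → v ⊑ u × Y n u} step (⊑-refl , p)
      where
      a₀ = m * n
      Y : ℕ → Pred W ℓ
      Y k = Ξ (k + a₀)
      Z : Pred W ℓ
      Z u = D u × Lift ℓ (m ≤ count (seen a₀ u) (modals t))
      open Region Z
      open Settling Z

      outside : ∀ {u} → ¬ Z u → Y 0 u → X u
      outside {u} ¬Zu y with em {D u}
      ... | no ¬Du = Ξ-outside a₀ ¬Du y
      ... | yes Du = sound-at m Du (≰⇒> (λ m≤ → ¬Zu (Du , lift m≤))) y

      -- At most `m` modalities are seen at `v` on the last level and at least `m` at `u` on the
      -- first, while the latter are among the former. So the two sets agree, together with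
      -- everything between them.
      level : ∀ {u} → v ⊑ u → Z u → ∀ {k l} → k ≤ n →
              All (λ a → seen (k + a₀) v a → seen (l + a₀) u a) (modals t)
      level {u} v⊑u (Du , lift m≤′) {k} {l} k≤n =
        All.zipWith (λ (f , g , h) q → h (g (f q)))
          (seen-mono Dv (+-monoˡ-≤ a₀ k≤n) , All.zip (back , seen-mono Du (m≤n+m a₀ l)))
        where
        back : All (λ a → seen (n + a₀) v a → seen a₀ u a) (modals t)
        back = count-≥⇒reverse
          (All.map (λ f q → near-down v⊑u (f q)) (seen-mono Du (m≤n+m a₀ n)))
          (≤-trans (≤-pred few) m≤′)

      -- A witness seen at `u` through no successor makes the part of `Z` above `u` a cluster. There
      -- all witnesses are settled on all levels of the block, so `ν-settles` applies from `u`.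
      exceptional : ∀ {u k a} → v ⊑ u → Z u → k ≤ n → a ∈ modals t →
                    seen (k + a₀) u a → ¬ Poss (witnesses a (Y k)) u → Y n u → X u
      exceptional {u} {k} {a} v⊑u Zu k≤n a∈ near-u ¬poss =
        ν-settles t {Y = Y} t-coinduction (λ k → Ξ-down (k + a₀))
          (λ _ → outside) (λ {k} _ _ _ → Ξ-unfold (k + a₀))
          (λ k k≤n → All.tabulate (λ {b} b∈ →
            (λ u⊑w Zw q → All.lookup (level (⊑-trans v⊑u u⊑w) Zw {l = k} k≤n) b∈ (near-down v⊑u q)) ,
            inj₁ (λ {w} {w′} → cluster {w} {w′})))
          ⊑-refl
        where
        cluster : Cluster u
        cluster = isolated⇒cluster
          (λ u⊑w Zw →
            All.lookup (level (⊑-trans v⊑u u⊑w) Zw {l = k} k≤n) a∈ (near-down v⊑u near-u))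
          ¬poss

      step : ∀ {u} → v ⊑ u × Y n u → X u ⊎ ⟦ t ⟧ˢ (λ w → (v ⊑ w × Y n w) ⊎ X w) u
      step {u} (v⊑u , y) with em {X u} | em {Z u}
      ... | yes Xu | _      = inj₁ Xu
      ... | no _   | no ¬Zu = inj₁ (outside ¬Zu (Ξ-descend (m≤n+m a₀ n) y))
      -- As `steps` is positive, level `n` can be unfolded once, to level `n′`. Passing back to `n`
      -- changes no modal fact at `u`: otherwise `u` would be exceptional and lie in `X`.
      ... | no ¬Xu | yes Zu with steps-suc (modals t)
      ...   | n′ , n≡ with Ξ-unfold (n′ + a₀) (subst (λ k → Y k u) n≡ y)
      ...     | inj₁ Xu = inj₁ Xu
      ...     | inj₂ q  = inj₂ (ˢ-local t {v ⊑_} ⊑-up (λ v⊑w y′ → inj₁ (v⊑w , y′)) v⊑u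
                            (transfer t (All.zip (move n′≤n ≤-refl , move ≤-refl n′≤n)) (λ _ → y) q))
        where
        n′≤n : n′ ≤ n
        n′≤n = subst (n′ ≤_) (sym n≡) (n≤1+n n′)
        move : ∀ {k l} → k ≤ n → l ≤ n →
               All (λ a → Poss (witnesses a (Y k)) u → Poss (witnesses a (Y l)) u) (modals t)
        move {l = l} k≤n l≤n = All.tabulate λ a∈ p → stable λ ¬poss →
          ¬Xu (exceptional v⊑u Zu l≤n a∈
                (All.lookup (level v⊑u Zu {l = l} k≤n) a∈ (near-down v⊑u (inj₂ p))) ¬poss y)

    stage-sound : ⟦ stage lo t ⟧ᶠ V ⊆ X
    stage-sound {u} p with em {D u}
    ... | no ¬Du = Ξ-outside (rounds t) ¬Du (inj₂ p)
    ... | yes Du = sound-at (suc (length (modals t))) Du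
                     (s≤s (count-≤-length _ (modals t))) (inj₂ p)

  stages-sound : ∀ {lo} → ⟦ lo ⟧ᶠ V ⊆ X → ∀ ts → (∀ {t} → t ∈ ts → Kill t s) →
                 ⟦ stages lo ts ⟧ᶠ V ⊆ X
  stages-sound lo⊆X []       kill p        = lo⊆X p
  stages-sound {lo} lo⊆X (t ∷ ts) kill (inj₁ p) =
    StageSound.stage-sound lo lo⊆X t (λ {Y} → kill (here refl) {Y}) p
  stages-sound lo⊆X (t ∷ ts) kill (inj₂ p) = stages-sound lo⊆X ts (λ t∈ → kill (there t∈)) p

  low-sound : ∀ c → ⟦ low c ⟧ᶠ V ⊆ X
  low-sound (suc c) = stages-sound (low-sound c) (kills s) (kills-sound s)

  -- Completeness, by the diamonds seen under the true fixed point.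

  typeAt : Skeleton Lit (Flat false) → W → Skeleton Lit (Flat false)
  typeAt (leaf l)     u = leaf l
  typeAt (t ∧ t′)     u = typeAt t u ∧ typeAt t′ u
  typeAt (t ∨ t′)     u = typeAt t u ∨ typeAt t′ u
  typeAt (mod nec A)  u = mod nec A
  typeAt (mod poss A) u with em {Near (⟦ A ⟧ᶠ (V [ x ≔ X ])) u}
  ... | yes _ = mod poss A
  ... | no _  = leaf ⊥ˡ

  typeAt-∈ : ∀ t {u} → typeAt t u ∈ kills t
  typeAt-∈ (leaf l)     = here refl
  typeAt-∈ (t ∧ t′)     = ∈-cartesianProductWith⁺ _∧_ (typeAt-∈ t) (typeAt-∈ t′)
  typeAt-∈ (t ∨ t′)     = ∈-cartesianProductWith⁺ _∨_ (typeAt-∈ t) (typeAt-∈ t′)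
  typeAt-∈ (mod nec A)  = here refl
  typeAt-∈ (mod poss A) {u} with em {Near (⟦ A ⟧ᶠ (V [ x ≔ X ])) u}
  ... | yes _ = there (here refl)
  ... | no _  = here refl

  typeAt-complete : ∀ t {u} → ⟦ t ⟧ˢ X u → ⟦ typeAt t u ⟧ˢ X u
  typeAt-complete (leaf l)     p        = p
  typeAt-complete (t ∧ t′)     (p , q)  = typeAt-complete t p , typeAt-complete t′ q
  typeAt-complete (t ∨ t′)     (inj₁ p) = inj₁ (typeAt-complete t p)
  typeAt-complete (t ∨ t′)     (inj₂ q) = inj₂ (typeAt-complete t′ q)
  typeAt-complete (mod nec A)  p        = p
  typeAt-complete (mod poss A) {u} p with em {Near (⟦ A ⟧ᶠ (V [ x ≔ X ])) u}
  ... | yes _    = p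
  ... | no ¬near = contradiction (inj₂ p) ¬near

  typeAt-visible : ∀ t {u} → All (Visible (λ A → ⟦ A ⟧ᶠ (V [ x ≔ X ])) u) (modals (typeAt t u))
  typeAt-visible (leaf l)     = []
  typeAt-visible (t ∧ t′)     = ++⁺ (typeAt-visible t) (typeAt-visible t′)
  typeAt-visible (t ∨ t′)     = ++⁺ (typeAt-visible t) (typeAt-visible t′)
  typeAt-visible (mod nec A)  = tt ∷ []
  typeAt-visible (mod poss A) {u} with em {Near (⟦ A ⟧ᶠ (V [ x ≔ X ])) u}
  ... | yes near-u = near-u ∷ []
  ... | no _       = []

  diamonds-anti : ∀ t {u v} → u ⊑ v → diamonds (typeAt t v) ≤ diamonds (typeAt t u)
  diamonds-anti (leaf l)     u⊑v = z≤n
  diamonds-anti (t ∧ t′)     u⊑v = +-mono-≤ (diamonds-anti t u⊑v) (diamonds-anti t′ u⊑v)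
  diamonds-anti (t ∨ t′)     u⊑v = +-mono-≤ (diamonds-anti t u⊑v) (diamonds-anti t′ u⊑v)
  diamonds-anti (mod nec A)  u⊑v = z≤n
  diamonds-anti (mod poss A) {u} {v} u⊑v
    with em {Near (⟦ A ⟧ᶠ (V [ x ≔ X ])) u} | em {Near (⟦ A ⟧ᶠ (V [ x ≔ X ])) v}
  ... | yes _ | yes _      = ≤-refl
  ... | yes _ | no _       = z≤n
  ... | no _  | no _       = z≤n
  ... | no ¬p | yes near-v = contradiction (near-down u⊑v near-v) ¬p

  -- Going up, seen diamonds can only be lost; if their number does not drop, none is lost.
  typeAt-cong : ∀ t {u v} → u ⊑ v → diamonds (typeAt t u) ≤ diamonds (typeAt t v) →
                typeAt t v ≡ typeAt t u
  typeAt-cong (leaf l)     u⊑v _  = refl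
  typeAt-cong (t ∧ t′)     u⊑v d≤ =
    let d₁ , d₂ = +-≤-split (diamonds-anti t u⊑v) (diamonds-anti t′ u⊑v) d≤
    in cong₂ _∧_ (typeAt-cong t u⊑v d₁) (typeAt-cong t′ u⊑v d₂)
  typeAt-cong (t ∨ t′)     u⊑v d≤ =
    let d₁ , d₂ = +-≤-split (diamonds-anti t u⊑v) (diamonds-anti t′ u⊑v) d≤
    in cong₂ _∨_ (typeAt-cong t u⊑v d₁) (typeAt-cong t′ u⊑v d₂)
  typeAt-cong (mod nec A)  u⊑v _  = refl
  typeAt-cong (mod poss A) {u} {v} u⊑v d≤
    with em {Near (⟦ A ⟧ᶠ (V [ x ≔ X ])) u} | em {Near (⟦ A ⟧ᶠ (V [ x ≔ X ])) v}
  ... | yes _ | yes _      = refl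
  ... | yes _ | no _       = contradiction d≤ λ ()
  ... | no _  | no _       = refl
  ... | no ¬p | yes near-v = contradiction (near-down u⊑v near-v) ¬p

  diamonds-typeAt : ∀ t {u} → diamonds (typeAt t u) ≤ diamonds t
  diamonds-typeAt (leaf l)     = z≤n
  diamonds-typeAt (t ∧ t′)     = +-mono-≤ (diamonds-typeAt t) (diamonds-typeAt t′)
  diamonds-typeAt (t ∨ t′)     = +-mono-≤ (diamonds-typeAt t) (diamonds-typeAt t′)
  diamonds-typeAt (mod nec A)  = z≤n
  diamonds-typeAt (mod poss A) {u} with em {Near (⟦ A ⟧ᶠ (V [ x ≔ X ])) u}
  ... | yes _ = ≤-refl
  ... | no _  = z≤n

  module StageComplete (lo : Flat false) (lo⊆X : ⟦ lo ⟧ᶠ V ⊆ X) (t : Skeleton Lit (Flat false))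
    (X⊆lo : ∀ {u} → diamonds (typeAt s u) < diamonds t → X u → ⟦ lo ⟧ᶠ V u) where

    Z Lower : Pred W ℓ
    Z u     = Lift ℓ (typeAt s u ≡ t)
    Lower u = Lift ℓ (diamonds (typeAt s u) < diamonds t)

    Z-or-lower : ∀ {u v} → Z u → u ⊑ v → ¬ Z v → Lower v
    Z-or-lower {u} {v} (lift refl) u⊑v ¬Zv with diamonds (typeAt s u) ≤? diamonds (typeAt s v)
    ... | yes d≤ = contradiction (lift (typeAt-cong s u⊑v d≤)) ¬Zv
    ... | no d≰  = lift (≰⇒> d≰)

    lower-up : ∀ {u v} → Lower u → u ⊑ v → Lower v
    lower-up (lift d<) u⊑v = lift (≤-<-trans (diamonds-anti s u⊑v) d<)

    lower∌Z : ∀ {u} → Lower u → ¬ Z u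
    lower∌Z (lift d<) (lift refl) = <-irrefl refl d<

    open Region Z
    open HatComplete Z V x lo X lo⊆X
      (λ Zv v⊑u ¬Zu → X⊆lo (lower (Z-or-lower Zv v⊑u ¬Zu)))
      (λ Zv v⊑u ¬Zu u⊑w → lower∌Z (lower-up (Z-or-lower Zv v⊑u ¬Zu) u⊑w))

    t-complete : ∀ {u} → Z u → X u → ⟦ t ⟧ˢ X u
    t-complete (lift refl) Xu = typeAt-complete s (ν-unfold (ˢ-mono s) Xu)

    n : ℕ
    n = steps (modals t)

    inner-covers : ∀ k → Eventually (Covers (inner lo t k))
    inner-covers zero = always covers
      where
      covers : ∀ {v} → Z v → Covers (inner lo t 0) v
      covers Zv {u} v⊑u Xu with em {Z u}
      ... | yes Zu = inj₂ Zu
      ... | no ¬Zu = inj₁ (X⊆lo (lower (Z-or-lower Zv v⊑u ¬Zu)) Xu)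
    inner-covers (suc k) = eventually-map
      (eventually-× (inner-covers k) (hat-complete (inner lo t k) (inner-covers k) (flatten t) rec))
      (λ _ Zv (f , g) → covers Zv f g)
      where
      covers : ∀ {v} → Z v → Covers (inner lo t k) v → Complete (inner lo t k) (flatten t) rec v →
               Covers (inner lo t (suc k)) v
      covers Zv f g {u} v⊑u Xu with em {Z u}
      ... | no ¬Zu = inj₁ (X⊆lo (lower (Z-or-lower Zv v⊑u ¬Zu)) Xu)
      ... | yes Zu = inj₂ (Zu , f v⊑u Xu ,
              g v⊑u (sem-closed (flatten t) (from (flatten-sem t) (t-complete Zu Xu))))

    -- Above `w` pick a point `v` from which the approximations are complete. The part of `Z` in its
    -- cone is then a postfixed point of `persistence`.
    region-complete : Z ⊆ ⟦ region lo t ⟧ᶠ V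
    region-complete {w} Zw =
      let v , w⊑v , Zv , h = cone (eventually-All
            (λ (_ , A) → hat-complete (inner lo t n) (inner-covers n) A rec) (modals t)) Zw
      in near⁺ w⊑v (ν-coinduction {P = λ u → v ⊑ u × Z u} (sem-mono (persistence lo t))
           (λ {u} (v⊑u , Zu) → from (persist-sem _ (modals t))
             (All.zipWith {P = λ a → Complete (inner lo t n) (proj₂ a) rec v}
               (λ {a} (f , vis) → visible-step v⊑u a f vis)
               (h v ⊑-refl Zv , visible Zu)))
           (⊑-refl , Zv))
      where
      visible : ∀ {u} → Z u → All (Visible (λ A → ⟦ A ⟧ᶠ (V [ x ≔ X ])) u) (modals t)
      visible (lift refl) = typeAt-visible s
      visible-step : ∀ {v u} → v ⊑ u → ∀ a → Complete (inner lo t n) (proj₂ a) rec v →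
        Visible (λ A → ⟦ A ⟧ᶠ (V [ x ≔ X ])) u a →
        Visible (λ A → sem (hat x lo (inner lo t n) A rec) V (λ u → v ⊑ u × Z u)) u a
      visible-step v⊑u (nec , A) f vis = tt
      visible-step {v} v⊑u (poss , A) f vis =
        let w , u⊑w , p = near⁻ vis
            v⊑w = ⊑-trans v⊑u u⊑w
        -- Shrinking `rec` from `Z` to its part above `v` cannot be noticed from within the cone of
        -- `v`.
        in near⁺ u⊑w (sem-local {D = v ⊑_} ⊑-up (λ _ _ q → q) (hat x lo (inner lo t n) A rec)
             (λ v⊑w Zw → v⊑w , Zw) v⊑w (f v⊑w (sem-closed A p)))

    -- Points of the current type or lower form an upward closed set, on which `X` stays below every
    -- iterate; no stabilization enters.
    outer-complete : ∀ k {u} → Z u ⊎ Lower u → X u → ⟦ outer lo t k ⟧ᶠ V u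
    outer-complete zero    (inj₂ (lift d<)) Xu = inj₁ (X⊆lo d< Xu)
    outer-complete (suc k) (inj₂ (lift d<)) Xu = inj₁ (X⊆lo d< Xu)
    outer-complete zero    (inj₁ Zu) Xu = inj₂ (region-complete Zu)
    outer-complete (suc k) (inj₁ Zu) Xu = inj₂ (region-complete Zu , outer-complete k (inj₁ Zu) Xu ,
      from (sub-sem x (outer lo t k) (flatten t) {Empty})
        (subst-local {D = λ u → Z u ⊎ Lower u} up (outer-complete k) (flatten t) {Empty} (λ _ p → p)
          (inj₁ Zu) (from (flatten-sem t) (t-complete Zu Xu))))
      where
      up : UpClosed (λ u → Z u ⊎ Lower u)
      up (inj₂ l)  R = inj₂ (lower-up l (inj₂ R))
      up {v = v} (inj₁ Zu) R with em {Z v}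
      ... | yes Zv = inj₁ Zv
      ... | no ¬Zv = inj₂ (Z-or-lower Zu (inj₂ R) ¬Zv)

  stages-⊇-lo : ∀ {lo} ts → ⟦ lo ⟧ᶠ V ⊆ ⟦ stages lo ts ⟧ᶠ V
  stages-⊇-lo []       p = p
  stages-⊇-lo (t ∷ ts) p = inj₂ (stages-⊇-lo ts p)

  stages-⊇-stage : ∀ {lo t ts} → t ∈ ts → ⟦ stage lo t ⟧ᶠ V ⊆ ⟦ stages lo ts ⟧ᶠ V
  stages-⊇-stage (here refl) p = inj₁ p
  stages-⊇-stage (there t∈)  p = inj₂ (stages-⊇-stage t∈ p)

  -- A point with exactly `c` seen diamonds is caught by the stage of its own type, points with
  -- fewer by the previous `low`.
  low-complete : ∀ c {u} → diamonds (typeAt s u) < c → X u → ⟦ low c ⟧ᶠ V u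
  low-complete (suc c) {u} (s≤s d≤c) Xu with m≤n⇒m<n∨m≡n d≤c
  ... | inj₁ d<c  = stages-⊇-lo (kills s) (low-complete c d<c Xu)
  ... | inj₂ refl = stages-⊇-stage (typeAt-∈ s)
        (StageComplete.outer-complete (low c) (low-sound c) (typeAt s u) (low-complete c)
          (rounds (typeAt s u)) (inj₁ (lift refl)) Xu)

  solution-sem : ⟦ solution ⟧ᶠ V ⇔₁ X
  solution-sem = low-sound (suc (diamonds s)) ⇆ low-complete _ (s≤s (diamonds-typeAt s))

-- Translating formulas to flat ones and back.

eliminate : Fix → Var → Flat false → Flat false
eliminate `ν x A = eliminate-ν x A
eliminate `μ x A = dual (eliminate-ν x (dual A))

flat : Formula → Flat false
flat `⊤           = lit ⊤ˡ
flat (`var x)     = lit (var x)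
flat (`atom p)    = lit (atom p)
flat (`¬atom p)   = lit (¬atom p)
flat (φ `∧ ψ)     = flat φ ∧ flat ψ
flat (φ `∨ ψ)     = flat φ ∨ flat ψ
flat (`◇ φ)       = mod poss (flat φ)
flat (`□ φ)       = mod nec (flat φ)
flat (`fix ρ x φ) = eliminate ρ x (flat φ)

bound : Flat r → ℕ
bound (lit (var x)) = suc x
bound (lit _)       = 0
bound (A ∧ B)       = bound A ⊔ bound B
bound (A ∨ B)       = bound A ⊔ bound B
bound (mod k A)     = bound A
bound rec           = 0
bound (con A)       = bound A
bound (fix ρ b)     = bound b

-- y is the name of rec.
toFormula : Flat r → Var → Formula
toFormula (lit ⊤ˡ)        y = `⊤
toFormula (lit ⊥ˡ)        y = `fix `μ 0 (`var 0)
toFormula (lit (var x))   y = `var x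
toFormula (lit (atom p))  y = `atom p
toFormula (lit (¬atom p)) y = `¬atom p
toFormula (A ∧ B)         y = toFormula A y `∧ toFormula B y
toFormula (A ∨ B)         y = toFormula A y `∨ toFormula B y
toFormula (mod poss A)    y = `◇ (toFormula A y)
toFormula (mod nec A)     y = `□ (toFormula A y)
toFormula rec             y = `var y
toFormula (con A)         y = toFormula A y
toFormula (fix ρ b)       y = `fix ρ (bound b) (toFormula b (bound b))

free⇒<bound : (A : Flat r) → ∀ {x y} → x FreeIn toFormula A y → x < bound A ⊎ x ≡ y
free⇒<bound (lit ⊥ˡ)      (fix x≢0 var) = contradiction refl x≢0
free⇒<bound (lit (var x)) var    = inj₁ ≤-refl
free⇒<bound (A ∧ B) (∧ˡ f) = [ (λ x< → inj₁ (≤-trans x< (m≤m⊔n _ _))) , inj₂ ]′ (free⇒<bound A f)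
free⇒<bound (A ∧ B) (∧ʳ f) = [ (λ x< → inj₁ (≤-trans x< (m≤n⊔m (bound A) _))) , inj₂ ]′ (free⇒<bound B f)
free⇒<bound (A ∨ B) (∨ˡ f) = [ (λ x< → inj₁ (≤-trans x< (m≤m⊔n _ _))) , inj₂ ]′ (free⇒<bound A f)
free⇒<bound (A ∨ B) (∨ʳ f) = [ (λ x< → inj₁ (≤-trans x< (m≤n⊔m (bound A) _))) , inj₂ ]′ (free⇒<bound B f)
free⇒<bound (mod poss A) (◇ f) = free⇒<bound A f
free⇒<bound (mod nec A)  (□ f) = free⇒<bound A f
free⇒<bound rec          var   = inj₂ refl
free⇒<bound (con A)      f     = free⇒<bound A f
free⇒<bound (fix ρ b) (fix x≢ f) = [ inj₁ , (λ x≡ → contradiction x≡ x≢) ]′ (free⇒<bound b f)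

-- Fixed points inside a body sit under `con`, out of reach of its `rec`. Hence `bound b`, the name
-- chosen for `rec`, is not free in them.
fix-free⇒<bound : (A : Flat r) → ∀ {y ρ z ψ x} → `fix ρ z ψ ≼ toFormula A y →
                  x FreeIn `fix ρ z ψ → x < bound A
fix-free⇒<bound (lit ⊥ˡ) here      (fix x≢0 var) = contradiction refl x≢0
fix-free⇒<bound (lit ⊥ˡ) (fix ())  f
fix-free⇒<bound (A ∧ B) (∧ˡ p) f = ≤-trans (fix-free⇒<bound A p f) (m≤m⊔n _ _)
fix-free⇒<bound (A ∧ B) (∧ʳ p) f = ≤-trans (fix-free⇒<bound B p f) (m≤n⊔m (bound A) _)
fix-free⇒<bound (A ∨ B) (∨ˡ p) f = ≤-trans (fix-free⇒<bound A p f) (m≤m⊔n _ _)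
fix-free⇒<bound (A ∨ B) (∨ʳ p) f = ≤-trans (fix-free⇒<bound B p f) (m≤n⊔m (bound A) _)
fix-free⇒<bound (mod poss A) (◇ p) f = fix-free⇒<bound A p f
fix-free⇒<bound (mod nec A)  (□ p) f = fix-free⇒<bound A p f
fix-free⇒<bound (con A)      p     f = fix-free⇒<bound A p f
fix-free⇒<bound (fix ρ b) (fix p)  f = fix-free⇒<bound b p f
fix-free⇒<bound (fix ρ b) here (fix x≢ f) =
  [ id , (λ x≡ → contradiction x≡ x≢) ]′ (free⇒<bound b f)

toFormula-flat : (A : Flat r) → ∀ {y} → NoNestedFixedPoints (toFormula A y)
toFormula-flat (lit ⊥ˡ) here     ()      f
toFormula-flat (lit ⊥ˡ) (fix ()) q       f
toFormula-flat (A ∧ B)      (∧ˡ p)  q f = toFormula-flat A p q f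
toFormula-flat (A ∧ B)      (∧ʳ p)  q f = toFormula-flat B p q f
toFormula-flat (A ∨ B)      (∨ˡ p)  q f = toFormula-flat A p q f
toFormula-flat (A ∨ B)      (∨ʳ p)  q f = toFormula-flat B p q f
toFormula-flat (mod poss A) (◇ p)   q f = toFormula-flat A p q f
toFormula-flat (mod nec A)  (□ p)   q f = toFormula-flat A p q f
toFormula-flat (con A)      p       q f = toFormula-flat A p q f
toFormula-flat (fix ρ b)    (fix p) q f = toFormula-flat b p q f
toFormula-flat (fix ρ b)    here    q f = <-irrefl refl (fix-free⇒<bound b q f)

-- Semantic correctness of the translations.

module Translation {ℓ} (em : ExcludedMiddle ℓ) (M : Model ℓ) (wk4 : WK4 M) where
  open Model M renaming (World to W)
  open Semantics M using (⟦_⟧; _[_↦_]; Assignment)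
  open FlatSemantics em M
  open WeaklyTransitive em M wk4

  eliminate-ν-sem : ∀ {V} x A →
    ⟦ eliminate-ν x A ⟧ᶠ V ⇔₁ FixedPoint `ν (λ Y → ⟦ A ⟧ᶠ (V [ x ≔ Y ]))
  eliminate-ν-sem {V} x A =
    FixedPoint-mono `ν (λ P⊆Q → sound ∘ from (flatten-sem s) ∘ ˢ-mono s P⊆Q) ∘ to solution-sem ⇆
    from solution-sem ∘ FixedPoint-mono `ν (λ P⊆Q → ˢ-mono s P⊆Q ∘ to (flatten-sem s) ∘ complete)
    where
    s = skeleton ⊤ˡ A A
    open Solution em M wk4 x s V
    sound : ∀ {V′} → ⟦ flatten s ⟧ᶠ V′ ⊆ ⟦ A ⟧ᶠ V′
    sound = sem-closed A ∘ skeleton-sound A ⊤ˡ A {All-worlds} (λ _ → tt) (λ _ → tt)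
    complete : ∀ {V′} → ⟦ A ⟧ᶠ V′ ⊆ ⟦ flatten s ⟧ᶠ V′
    complete = skeleton-complete A ⊤ˡ A (λ ()) (λ _ → tt)

  ∁ : Pred W ℓ → Pred W ℓ
  ∁ P w = ¬ P w

  ∁∁ : ∀ {P} → P ⇔₁ ∁ (∁ P)
  ∁∁ = (λ p ¬p → ¬p p) ⇆ stable

  -- Each inclusion is one induction or coinduction whose invariant is the complement of a fixed
  -- point.
  FixedPoint-dual : ∀ {F G} ρ → Monotone F → Monotone G → (∀ P → G (∁ P) ⇔₁ ∁ (F P)) →
                    FixedPoint (dualFix ρ) G ⇔₁ ∁ (FixedPoint ρ F)
  FixedPoint-dual {F} {G} `μ mF mG G∁ =
    (λ g f → μ-induction {P = ∁ (FixedPoint `ν G)} mF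
      (λ f′ g′ → to (G∁ (∁ (FixedPoint `ν G)))
        (mG (to (∁∁ {FixedPoint `ν G})) (ν-unfold mG g′)) f′) f g) ⇆
    ν-coinduction {P = ∁ (FixedPoint `μ F)} mG (λ ¬f → from (G∁ _) (λ f → ¬f (μ-fold mF f)))
  FixedPoint-dual {F} {G} `ν mF mG G∁ =
    μ-induction {P = ∁ (FixedPoint `ν F)} mG (λ g f → to (G∁ _) g (ν-unfold mF f)) ⇆
    (λ ¬f → stable λ ¬g → ¬f (ν-coinduction {P = ∁ (FixedPoint `μ G)} mF
      (λ ¬g′ → stable λ ¬f′ → ¬g′ (μ-fold mG
        (mG (from (∁∁ {FixedPoint `μ G})) (from (G∁ (∁ (FixedPoint `μ G))) ¬f′)))) ¬g))

  dual-sem : (A : Flat r) → ∀ {V V′ Y Y′} → (∀ y → V′ y ⇔₁ ∁ (V y)) → Y′ ⇔₁ ∁ Y →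
             sem (dual A) V′ Y′ ⇔₁ ∁ (sem A V Y)
  dual-sem (lit ⊤ˡ)        v y = (λ ()) ⇆ (λ ¬p → contradiction tt ¬p)
  dual-sem (lit ⊥ˡ)        v y = (λ _ ()) ⇆ (λ _ → tt)
  dual-sem (lit (var x))   v y = v x
  dual-sem (lit (atom p))  v y = id ⇆ id
  dual-sem (lit (¬atom p)) v y = ∁∁
  dual-sem (A ∧ B)         v y =
    [ (λ p (q , _) → to (dual-sem A v y) p q) , (λ p (_ , q) → to (dual-sem B v y) p q) ]′ ⇆
    (λ ¬pq → stable λ ¬∨ → ¬∨ (inj₁ (from (dual-sem A v y) (λ p →
      ¬∨ (inj₂ (from (dual-sem B v y) (λ q → ¬pq (p , q))))))))
  dual-sem (A ∨ B)         v y =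
    (λ (p , q) → [ to (dual-sem A v y) p , to (dual-sem B v y) q ]′) ⇆
    (λ ¬pq → from (dual-sem A v y) (¬pq ∘ inj₁) , from (dual-sem B v y) (¬pq ∘ inj₂))
  dual-sem (mod poss A)    v y =
    (λ p (u , R , q) → to (dual-sem A v y) (p u R) q) ⇆
    (λ ¬p u R → from (dual-sem A v y) (λ q → ¬p (u , R , q)))
  dual-sem (mod nec A)     v y =
    (λ (u , R , p) q → to (dual-sem A v y) p (q u R)) ⇆
    (λ ¬p → stable λ ¬q → ¬p (λ u R → stable λ ¬a → ¬q (u , R , from (dual-sem A v y) ¬a)))
  dual-sem rec             v y = y
  dual-sem (con A)         v y =
    to (dual-sem A v (id ⇆ id)) ∘ sem-closed (dual A) ⇆
    sem-closed (dual A) ∘ from (dual-sem A v (id ⇆ id))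
  dual-sem (fix ρ b)       v y =
    FixedPoint-dual ρ (sem-mono b) (sem-mono (dual b)) (λ P → dual-sem b v (id ⇆ id))

  eliminate-sem : ∀ {V} ρ x A →
    ⟦ eliminate ρ x A ⟧ᶠ V ⇔₁ FixedPoint ρ (λ Y → ⟦ A ⟧ᶠ (V [ x ≔ Y ]))
  eliminate-sem `ν x A = eliminate-ν-sem x A
  eliminate-sem {V} `μ x A =
    (λ p → stable λ ¬q → to dual-elim p (from (eliminate-ν-sem x (dual A)) (from fixed ¬q))) ⇆
    (λ p → from dual-elim (λ q → to fixed (to (eliminate-ν-sem x (dual A)) q) p))
    where
    C = eliminate-ν x (dual A)
    -- The elimination for `ν` is applied at the complemented environment, and `dual` complements
    -- back.
    dual-elim : ⟦ dual C ⟧ᶠ V ⇔₁ ∁ (⟦ C ⟧ᶠ (λ y → ∁ (V y)))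
    dual-elim = to (dual-sem C (λ _ → ∁∁) (id ⇆ id)) ∘ sem-closed (dual C) ⇆
                sem-closed (dual C) ∘ from (dual-sem C (λ _ → ∁∁) (id ⇆ id))
    fixed : FixedPoint `ν (λ Y → ⟦ dual A ⟧ᶠ ((λ y → ∁ (V y)) [ x ≔ Y ])) ⇔₁
            ∁ (FixedPoint `μ (λ Y → ⟦ A ⟧ᶠ (V [ x ≔ Y ])))
    fixed = FixedPoint-dual `μ (λ P⊆Q → subst-mono P⊆Q A) (λ P⊆Q → subst-mono P⊆Q (dual A))
      (λ P → to (dual-sem A (env-∁ x (λ _ → id ⇆ id)) (id ⇆ id)) ∘ sem-closed (dual A) ⇆
             sem-closed (dual A) ∘ from (dual-sem A (env-∁ x (λ _ → id ⇆ id)) (id ⇆ id)))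

  ⟪_⟫ᵉ : Assignment → Env
  ⟪ V ⟫ᵉ y = ⟪ V y ⟫

  update-env : ∀ V x X (A : Flat false) → ⟦ A ⟧ᶠ ⟪ V [ x ↦ X ] ⟫ᵉ ⇔₁ ⟦ A ⟧ᶠ (⟪ V ⟫ᵉ [ x ≔ ⟪ X ⟫ ])
  update-env V x X A =
    sem-local {D = All-worlds} (λ _ _ → tt) (λ y _ → to (update-sem V x X y)) A (λ _ p → p) tt ⇆
    sem-local {D = All-worlds} (λ _ _ → tt) (λ y _ → from (update-sem V x X y)) A (λ _ p → p) tt

  flat-sem : ∀ φ V → ⟦ φ ⟧ V ⇔₁ ⟦ flat φ ⟧ᶠ ⟪ V ⟫ᵉ
  flat-sem `⊤         V = id ⇆ id
  flat-sem (`var x)   V = id ⇆ id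
  flat-sem (`atom p)  V = id ⇆ id
  flat-sem (`¬atom p) V = id ⇆ id
  flat-sem (φ `∧ ψ)   V =
    (λ (p , q) → to (flat-sem φ V) p , to (flat-sem ψ V) q) ⇆
    (λ (p , q) → from (flat-sem φ V) p , from (flat-sem ψ V) q)
  flat-sem (φ `∨ ψ)   V =
    [ inj₁ ∘ to (flat-sem φ V) , inj₂ ∘ to (flat-sem ψ V) ]′ ⇆
    [ inj₁ ∘ from (flat-sem φ V) , inj₂ ∘ from (flat-sem ψ V) ]′
  flat-sem (`◇ φ)     V =
    Modal-mono poss (to (flat-sem φ V)) ⇆ Modal-mono poss (from (flat-sem φ V))
  flat-sem (`□ φ)     V =
    Modal-mono nec (to (flat-sem φ V)) ⇆ Modal-mono nec (from (flat-sem φ V))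
  flat-sem (`fix `μ x φ) V =
    (λ p → from (eliminate-sem `μ x (flat φ)) (λ X pre → p X (pre ∘ to (body X)))) ⇆
    (λ p X pre → to (eliminate-sem `μ x (flat φ)) p X (pre ∘ from (body X)))
    where
    body : ∀ X → ⟦ φ ⟧ (V [ x ↦ X ]) ⇔₁ ⟦ flat φ ⟧ᶠ (⟪ V ⟫ᵉ [ x ≔ ⟪ X ⟫ ])
    body X = to (update-env V x X (flat φ)) ∘ to (flat-sem φ (V [ x ↦ X ])) ⇆
             from (flat-sem φ (V [ x ↦ X ])) ∘ from (update-env V x X (flat φ))
  flat-sem (`fix `ν x φ) V =
    (λ (X , post , p) → from (eliminate-sem `ν x (flat φ)) (X , (λ q → to (body X) (post q)) , p)) ⇆
    (λ p → let X , post , q = to (eliminate-sem `ν x (flat φ)) p in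
      X , (λ q′ → from (body X) (post q′)) , q)
    where
    body : ∀ X → ⟦ φ ⟧ (V [ x ↦ X ]) ⇔₁ ⟦ flat φ ⟧ᶠ (⟪ V ⟫ᵉ [ x ≔ ⟪ X ⟫ ])
    body X = to (update-env V x X (flat φ)) ∘ to (flat-sem φ (V [ x ↦ X ])) ⇆
             from (flat-sem φ (V [ x ↦ X ])) ∘ from (update-env V x X (flat φ))

  -- Agreement is required only below `bound A`, so that it survives the update of the fresh name
  -- `bound b` at a fixed point.
  toFormula-sem : (A : Flat r) → ∀ {y V V′ Y} → (∀ z → z < bound A → ⟪ V z ⟫ ⇔₁ V′ z) →
                  ⟪ V y ⟫ ⇔₁ Y → ⟦ toFormula A y ⟧ V ⇔₁ sem A V′ Y
  toFormula-sem (lit ⊤ˡ)        v y = id ⇆ id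
  toFormula-sem (lit ⊥ˡ)        v y = (λ p → ⊥-elim (lower (p (λ _ → false) id))) ⇆ (λ ())
  toFormula-sem (lit (var x))   v y = v x ≤-refl
  toFormula-sem (lit (atom p))  v y = id ⇆ id
  toFormula-sem (lit (¬atom p)) v y = id ⇆ id
  toFormula-sem (A ∧ B) v y = (λ (p , q) → to ihA p , to ihB q) ⇆ (λ (p , q) → from ihA p , from ihB q)
    where
    ihA = toFormula-sem A (λ z z< → v z (≤-trans z< (m≤m⊔n _ _))) y
    ihB = toFormula-sem B (λ z z< → v z (≤-trans z< (m≤n⊔m (bound A) _))) y
  toFormula-sem (A ∨ B) v y =
    [ inj₁ ∘ to ihA , inj₂ ∘ to ihB ]′ ⇆ [ inj₁ ∘ from ihA , inj₂ ∘ from ihB ]′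
    where
    ihA = toFormula-sem A (λ z z< → v z (≤-trans z< (m≤m⊔n _ _))) y
    ihB = toFormula-sem B (λ z z< → v z (≤-trans z< (m≤n⊔m (bound A) _))) y
  toFormula-sem (mod poss A) v y =
    Modal-mono poss (to (toFormula-sem A v y)) ⇆ Modal-mono poss (from (toFormula-sem A v y))
  toFormula-sem (mod nec A)  v y =
    Modal-mono nec (to (toFormula-sem A v y)) ⇆ Modal-mono nec (from (toFormula-sem A v y))
  toFormula-sem rec          v y = y
  toFormula-sem (con A)      v y =
    sem-closed A ∘ to (toFormula-sem A v y) ⇆ from (toFormula-sem A v y) ∘ sem-closed A
  toFormula-sem (fix ρ b) {V = V} {V′} v y = by-cases ρ
    where
    n = bound b
    update-≢ : ∀ X z → z < n → ⟪ (V [ n ↦ X ]) z ⟫ ⇔₁ V′ z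
    update-≢ X z z<n rewrite dec-false (n ≟ z) (>⇒≢ z<n) = v z z<n
    update-≡ : ∀ X → ⟪ (V [ n ↦ X ]) n ⟫ ⇔₁ ⟪ X ⟫
    update-≡ X rewrite dec-true (n ≟ n) refl = id ⇆ id
    body : ∀ X → ⟦ toFormula b n ⟧ (V [ n ↦ X ]) ⇔₁ sem b V′ ⟪ X ⟫
    body X = toFormula-sem b (update-≢ X) (update-≡ X)
    by-cases : ∀ ρ → ⟦ `fix ρ n (toFormula b n) ⟧ V ⇔₁ FixedPoint ρ (sem b V′)
    by-cases `μ = (λ p X pre → p X (pre ∘ to (body X))) ⇆ (λ p X pre → p X (pre ∘ from (body X)))
    by-cases `ν = (λ (X , post , p) → X , (λ q → to (body X) (post q)) , p) ⇆
                  (λ (X , post , p) → X , (λ q → from (body X) (post q)) , p)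

-- The collapse over weakly transitive models.

flatten-equivalent : ExcludedMiddle ℓ → ∀ φ →
                     EquivalentOver (WK4 {ℓ}) φ (toFormula (flat φ) 0)
flatten-equivalent em φ M wk4 V w = mk⇔
  (from named ∘ sem-closed (flat φ) ∘ to (flat-sem φ V))
  (from (flat-sem φ V) ∘ sem-closed (flat φ) ∘ to named)
  where
  open FlatSemantics em M
  open Translation em M wk4
  named = toFormula-sem (flat φ) {0} {V} {⟪ V ⟫ᵉ} (λ _ _ → id ⇆ id) (id ⇆ id)

mainTheorem4 : ∀ {ℓ} → ExcludedMiddle ℓ →
    (∀ φ → ∃[ ψ ] NoNestedFixedPoints ψ × EquivalentOver (WK4 {ℓ}) φ ψ) ×
    (∀ φ → ∃[ ψ ] AlternationFree ψ × EquivalentOver (WK4 {ℓ}) φ ψ)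
mainTheorem4 em =
  (λ φ → toFormula (flat φ) 0 , toFormula-flat (flat φ) , flatten-equivalent em φ) ,
  (λ φ → toFormula (flat φ) 0 , (λ _ → toFormula-flat (flat φ)) , flatten-equivalent em φ)
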